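{- For integers $\nu\ge1$ and $n>\nu(3\nu+5)/2$, \[ (-1)^\nu\left(\sum_{\tau=0}^{\nu}(-1)^\tau p\!\left(n-\tfrac{\tau(3\tau+1)}{2}\right)-\sum_{\tau=0}^{\nu-1}(-1)^\tau p\!\left(n-\tfrac{\tau(3\tau+5)}{2}-1\right)\right)=p(2,3,\nu;n)+p(1,3,\nu;n). \]
   Context: $p(n)$ is the number of partitions of $n$. Definition of $M(a,m,\nu;n)$ (integers $\nu\ge0$, $1\le a<m$, $n\ge0$): for a partition $\lambda_1\ge\dots\ge\lambda_k$ of $n$ into parts $\equiv a\pmod m$, put $\ell_i=(\lambda_i-a)/m+1$ (the number of boxes of the row of $\lambda_i$ in the $m$-modular Young diagram), and let $t$ be the largest integer $0\le t\le k$ with $\ell_t\ge t+\nu+2$ (height of the $(\nu+2)$-Durfee rectangle, whose width is $t+\nu+2$). $M(a,m,\nu;n)$ counts partitions of $n$ into parts $\equiv a\pmod m$ in which each of $a,a+m,\dots,a+m\nu$ occurs at least once and $\ell_i<t+\nu+2$ for all $i>t$. Definition: $p(a,m,\nu;n)$ is the number of partitions of $n$ such that, if $\beta$ denotes the sum of the parts $\not\equiv a\pmod m$, the parts $\equiv a\pmod m$ form a partition of $n-\beta$ counted by $M(a,m,\nu;n-\beta)$. -}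

module Defs where

open import Data.Nat using (ℕ; zero; suc; _+_; _*_; _∸_; _≤_; _<_; _≥_; _≟_; _≤?_; _<?_; _≥?_; NonZero)
open import Data.Nat.DivMod using (_/_; _%_)
open import Data.List using (List; []; _∷_; [_]; map; concatMap; upTo; length; filter; drop)
open import Data.Nat.ListAction using (sum)
open import Data.List.Relation.Unary.All using (All; all?)
open import Data.List.Relation.Unary.Linked using (Linked; linked?)
open import Data.List.Membership.DecPropositional _≟_ using (_∈_; _∈?_)
open import Data.Product using (_×_)
open import Data.Unit using (⊤)
open import Relation.Nullary using (Dec; yes; no; ¬?)
open import Relation.Nullary.Decidable using (_×-dec_)
open import Relation.Binary.PropositionalEquality using (_≡_)
open import Data.Integer as ℤ using (ℤ)

IsPartition : ℕ → List ℕ → Set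
IsPartition n xs = Linked _≥_ xs × All (0 <_) xs × sum xs ≡ n

isPartition? : (n : ℕ) → (xs : List ℕ) → Dec (IsPartition n xs)
isPartition? n xs = linked? _≥?_ xs ×-dec all? (0 <?_) xs ×-dec (sum xs ≟ n)

listsOfLen : ℕ → ℕ → List (List ℕ)
listsOfLen n zero    = [ [] ]
listsOfLen n (suc k) = concatMap (λ x → map (x ∷_) (listsOfLen n k)) (map suc (upTo n))

-- all lists of length ≤ n with entries in {1,…,n}; every partition of n
-- occurs exactly once in this list.
candidates : ℕ → List (List ℕ)
candidates n = concatMap (listsOfLen n) (upTo (suc n))

#partitionsWith : (n : ℕ) (Q : List ℕ → Set) → (∀ xs → Dec (Q xs)) → ℕ
#partitionsWith n Q Q? = length (filter (λ xs → isPartition? n xs ×-dec Q? xs) (candidates n))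

p : ℕ → ℕ
p n = #partitionsWith n (λ _ → ⊤) (λ _ → yes Data.Unit.tt)

-- 0-indexed lookup with default 0 (ℓᵢ = at ℓs (i ∸ 1) for 1 ≤ i ≤ k)
at : List ℕ → ℕ → ℕ
at []       _       = 0
at (x ∷ xs) zero    = x
at (x ∷ xs) (suc i) = at xs i

-- ℓᵢ = (λᵢ - a)/m + 1 : number of boxes of the row of λᵢ in the m-modular diagram
rowLengths : (a m : ℕ) .{{_ : NonZero m}} → List ℕ → List ℕ
rowLengths a m xs = map (λ x → (x ∸ a) / m + 1) xs

durfeeAux : List ℕ → ℕ → ℕ → ℕ
durfeeAux ls c zero = 0
durfeeAux ls c (suc j) with suc j + c ≤? at ls j
... | yes _ = suc j
... | no  _ = durfeeAux ls c j

-- height t of the (ν+2)-Durfee rectangle: largest 0 ≤ t ≤ k with ℓₜ ≥ t + ν + 2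
durfeeHeight : (ν : ℕ) → List ℕ → ℕ
durfeeHeight ν ls = durfeeAux ls (ν + 2) (length ls)

MCond : (a m ν : ℕ) .{{_ : NonZero m}} → List ℕ → Set
MCond a m ν xs =
  All (λ j → (a + m * j) ∈ xs) (upTo (suc ν)) ×
  All (_< durfeeHeight ν ls + ν + 2) (drop (durfeeHeight ν ls) ls)
  where ls = rowLengths a m xs

MCond? : (a m ν : ℕ) .{{_ : NonZero m}} → (xs : List ℕ) → Dec (MCond a m ν xs)
MCond? a m ν xs =
  all? (λ j → (a + m * j) ∈? xs) (upTo (suc ν)) ×-dec
  all? (_<? durfeeHeight ν ls + ν + 2) (drop (durfeeHeight ν ls) ls)
  where ls = rowLengths a m xs

_≡[_]_ : ℕ → (m : ℕ) .{{_ : NonZero m}} → ℕ → Set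
x ≡[ m ] a = x % m ≡ a % m

-- parts-condition of M(a,m,ν;N) (the partition-of-N condition is added by the counting)
IsMPart : (a m ν : ℕ) .{{_ : NonZero m}} → List ℕ → Set
IsMPart a m ν xs = All (λ x → x ≡[ m ] a) xs × MCond a m ν xs

IsMPart? : (a m ν : ℕ) .{{_ : NonZero m}} → (xs : List ℕ) → Dec (IsMPart a m ν xs)
IsMPart? a m ν xs = all? (λ x → x % m ≟ a % m) xs ×-dec MCond? a m ν xs

M : (a m ν : ℕ) .{{_ : NonZero m}} → ℕ → ℕ
M a m ν N = #partitionsWith N (IsMPart a m ν) (IsMPart? a m ν)

CountedByM : (a m ν : ℕ) .{{_ : NonZero m}} → ℕ → List ℕ → Set
CountedByM a m ν N xs = IsPartition N xs × IsMPart a m ν xs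

CountedByM? : (a m ν : ℕ) .{{_ : NonZero m}} → (N : ℕ) → (xs : List ℕ) → Dec (CountedByM a m ν N xs)
CountedByM? a m ν N xs = isPartition? N xs ×-dec IsMPart? a m ν xs

partsCong : (a m : ℕ) .{{_ : NonZero m}} → List ℕ → List ℕ
partsCong a m xs = filter (λ x → x % m ≟ a % m) xs

partsNotCong : (a m : ℕ) .{{_ : NonZero m}} → List ℕ → List ℕ
partsNotCong a m xs = filter (λ x → ¬? (x % m ≟ a % m)) xs

PCond : (a m ν : ℕ) .{{_ : NonZero m}} → ℕ → List ℕ → Set
PCond a m ν n xs = CountedByM a m ν (n ∸ sum (partsNotCong a m xs)) (partsCong a m xs)

PCond? : (a m ν : ℕ) .{{_ : NonZero m}} → (n : ℕ) → (xs : List ℕ) → Dec (PCond a m ν n xs)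
PCond? a m ν n xs = CountedByM? a m ν (n ∸ sum (partsNotCong a m xs)) (partsCong a m xs)

pν : (a m ν : ℕ) .{{_ : NonZero m}} → ℕ → ℕ
pν a m ν n = #partitionsWith n (PCond a m ν n) (PCond? a m ν n)

sumTo : ℕ → (ℕ → ℤ) → ℤ
sumTo zero    f = f 0
sumTo (suc k) f = sumTo k f ℤ.+ f (suc k)

{-# OPTIONS --safe #-}
module Submission where

open import Defs
open import Data.Bool using (true; false)
open import Data.List using (List; []; _∷_; _++_; map; concatMap; cartesianProductWith; drop; filter; length; replicate; upTo)
open import Data.List.Membership.Propositional using (_∈_)
open import Data.List.Membership.Propositional.Properties using (∈-filter⁺; ∈-filter⁻; ∈-map⁺; ∈-map⁻; ∈-upTo⁺; ∈-upTo⁻; ∈-concat⁺′; ∈-cartesianProductWith⁺; ∈-cartesianProductWith⁻)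
open import Data.List.Membership.Propositional.Properties.WithK using (unique∧set⇒bag)
import Data.List.Properties as List
open import Data.List.Relation.Binary.BagAndSetEquality using (∼bag⇒↭)
open import Data.List.Relation.Binary.Permutation.Propositional using (_↭_; ↭-refl; ↭-sym; ↭-trans; ↭-reflexive; ↭-prep; ↭-swap; ↭⇒↭ₛ; ↭ₛ⇒↭)
open import Data.List.Relation.Binary.Permutation.Propositional.Properties as ↭ using (∈-resp-↭; All-resp-↭; drop-∷; ↭-length; filter-↭)
open import Data.List.Relation.Binary.Permutation.Setoid.Properties using (partition-↭)
open import Data.List.Relation.Binary.Pointwise using (Pointwise-≡⇒≡)
open import Data.List.Relation.Unary.All as All using (All; []; _∷_)
import Data.List.Relation.Unary.All.Properties as All
open import Data.List.Relation.Unary.AllPairs as AllPairs using ([]; _∷_)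
import Data.List.Relation.Unary.AllPairs.Properties as AllPairs
open import Data.List.Relation.Unary.Any using (here; there)
open import Data.List.Relation.Unary.Linked as Linked using (Linked; []; [-]; _∷_; linked?)
import Data.List.Relation.Unary.Linked.Properties as Linked
import Data.List.Relation.Unary.Sorted.TotalOrder.Properties as Sorted
open import Data.List.Relation.Unary.Unique.Propositional using (Unique)
import Data.List.Relation.Unary.Unique.Propositional.Properties as Unique
open import Data.Nat using (ℕ; zero; suc; 2+; pred; _+_; _*_; _∸_; _≤_; _<_; _≥_; z≤n; s≤s; z<s; s<s; s≤s⁻¹; _≟_; _≤?_; _<?_; _≥?_; _≤ᵇ_; NonZero)
open import Data.Nat.DivMod using (_/_; _%_; m*n/n≡m; m≡m%n+[m/n]*n; m<n⇒m%n≡m; [m+kn]%n≡m%n; /-monoˡ-≤)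
open import Data.Nat.ListAction using (sum)
open import Data.Nat.ListAction.Properties using (sum-↭; sum-++)
open import Data.Nat.Properties
open import Data.Nat.Tactic.RingSolver using (solve-∀)
open import Data.Product using (_×_; _,_; proj₁; proj₂; map₁)
open import Data.Sum as Sum using (_⊎_; inj₁; inj₂)
open import Data.Unit using (⊤; tt)
open import Function using (_∘_; id; _⇔_; mk⇔; Equivalence)
open import Function.Construct.Composition using (_⇔-∘_)
open import Function.Construct.Identity using (⇔-id)
open import Level using (Level; 0ℓ; _⊔_)
open import Relation.Binary.Bundles using (DecTotalOrder)
import Relation.Binary.Construct.Flip.EqAndOrd as Flip
open import Relation.Binary.Definitions using (tri<; tri≈; tri>)
open import Relation.Binary.PropositionalEquality using (_≡_; _≢_; refl; sym; trans; cong; cong₂; subst; setoid; module ≡-Reasoning)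
open import Relation.Nullary using (yes; no; ofʸ; ¬_; ¬?; contradiction)
open import Relation.Nullary.Decidable using (_×-dec_; map′)
open import Relation.Unary using (Pred; Decidable; _⊆_; _∩_; _≐_; _⊢_; ∁)
open import Relation.Unary.Properties using (∁?)

-- Write i₀ ≥ i₁ ≥ … for the indices (x − a)/m of the parts x ≡ a (mod m) of a partition.
-- The sequence i_t − t strictly decreases, and the Durfee condition in the definition of
-- p(a,m,ν;n) says that it skips the value ν + 1.  Inserting one part of each of the indices
-- 0, …, ν does not affect this, so p(a,m,ν;n) is the case k = ν + 1 of
--
--   S(k) = #{ λ ⊢ n − w(k) : λ skips k },   w(k) = a + (a + m) + ⋯ + (a + m(k − 1)).
--
-- If instead i_t − t = k for some t, then adding one box to the first t rows and deleting
-- row i_t gives a partition of n − w(k+1) that skips k + 1, bijectively.  Hence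
-- S(k) + S(k+1) = p(n − w(k)).  Let m = 3 and write S₁, S₂ for the cases a = 1, 2.  Then the
-- w(k) are the two families of pentagonal numbers, and the two sums of the theorem telescope
-- to S₂(0) ± S₂(ν+1) and S₁(1) ± S₁(ν+1).
--
-- It remains to see that S₂(0) = S₁(1), which is the pentagonal number theorem.  Dyson's map
-- removes the first column of a partition, of length t, and adds a row of length t + s.  It
-- sends the partitions of N of rank ≤ s + 1 bijectively to the partitions of N + s of rank
-- ≥ s − 1.  With s = 3j + 2 this shows that A(j) = #{ λ ⊢ n − j(3j+1)/2 : rank λ ≤ 3j }
-- satisfies A(j) + A(j+1) = p(n − j(3j+1)/2) for all integers j.  So S₂(k) and A(k) obey the
-- same recurrence, as do S₁(k+1) and A(−k); all of them vanish for large k, hence agree, and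
-- S₂(0) = A(0) = S₁(1).

private
  variable
    a b c p₁ p₂ p₃ p₄ : Level
    A : Set a
    B : Set b
    C : Set c
    n e e′ : ℕ

infix 4 _≃_ _Enumerates_

record _≃_ {A : Set a} {B : Set b} (P : Pred A p₁) (Q : Pred B p₂) : Set (a ⊔ b ⊔ p₁ ⊔ p₂) where
  field
    to      : A → B
    from    : B → A
    to-∈    : ∀ {x} → P x → Q (to x)
    from-∈  : ∀ {y} → Q y → P (from y)
    from∘to : ∀ {x} → P x → from (to x) ≡ x
    to∘from : ∀ {y} → Q y → to (from y) ≡ y

open _≃_

≐⇒≃ : {P : Pred A p₁} {Q : Pred A p₂} → P ≐ Q → P ≃ Q
≐⇒≃ (P⊆Q , Q⊆P) = record
  { to      = id
  ; from    = id
  ; to-∈    = P⊆Q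
  ; from-∈  = Q⊆P
  ; from∘to = λ _ → refl
  ; to∘from = λ _ → refl
  }

module _ {P : Pred A p₁} {Q : Pred B p₂} where

  ≃-sym : P ≃ Q → Q ≃ P
  ≃-sym θ = record
    { to      = from θ
    ; from    = to θ
    ; to-∈    = from-∈ θ
    ; from-∈  = to-∈ θ
    ; from∘to = to∘from θ
    ; to∘from = from∘to θ
    }

  ≃-trans : {R : Pred C p₃} → P ≃ Q → Q ≃ R → P ≃ R
  ≃-trans θ ζ = record
    { to      = to ζ ∘ to θ
    ; from    = from θ ∘ from ζ
    ; to-∈    = to-∈ ζ ∘ to-∈ θ
    ; from-∈  = from-∈ θ ∘ from-∈ ζ
    ; from∘to = λ Px → trans (cong (from θ) (from∘to ζ (to-∈ θ Px))) (from∘to θ Px)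
    ; to∘from = λ Rz → trans (cong (to ζ) (to∘from θ (from-∈ ζ Rz))) (to∘from ζ Rz)
    }

  ≃-∩ : {P′ : Pred A p₃} {Q′ : Pred B p₄} (θ : P ≃ Q) →
    (∀ {x} → P x → P′ x ⇔ Q′ (to θ x)) → P ∩ P′ ≃ Q ∩ Q′
  ≃-∩ {Q′ = Q′} θ P′⇔Q′ = record
    { to      = to θ
    ; from    = from θ
    ; to-∈    = λ (Px , P′x) → to-∈ θ Px , Equivalence.to (P′⇔Q′ Px) P′x
    ; from-∈  = λ (Qy , Q′y) → from-∈ θ Qy ,
        Equivalence.from (P′⇔Q′ (from-∈ θ Qy)) (subst Q′ (sym (to∘from θ Qy)) Q′y)
    ; from∘to = from∘to θ ∘ proj₁
    ; to∘from = to∘from θ ∘ proj₁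
    }

record _Enumerates_ {A : Set a} (xs : List A) (P : Pred A p₁) : Set (a ⊔ p₁) where
  field
    unique   : Unique xs
    sound    : ∀ {x} → x ∈ xs → P x
    complete : ∀ {x} → P x → x ∈ xs

open _Enumerates_

module _ {P : Pred A p₁} {Q : Pred B p₂} (θ : P ≃ Q) {xs : List A} {ys : List B} where

  ≃⇒length≡ : xs Enumerates P → ys Enumerates Q → length xs ≡ length ys
  ≃⇒length≡ xs-enum ys-enum = trans (sym (List.length-map (to θ) xs)) (↭-length map-to-xs↭ys)
    where
    to-injective : ∀ {x y} → P x → P y → to θ x ≡ to θ y → x ≡ y
    to-injective Px Py eq = trans (sym (from∘to θ Px)) (trans (cong (from θ) eq) (from∘to θ Py))

    map-to-unique : ∀ {zs} → All P zs → Unique zs → Unique (map (to θ) zs)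
    map-to-unique []         []         = []
    map-to-unique (Pz ∷ Pzs) (z∉ ∷ uniq) =
      All.map⁺ (All.zipWith (λ (Py , z≢y) → z≢y ∘ to-injective Pz Py) (Pzs , z∉)) ∷
      map-to-unique Pzs uniq

    map-to-xs⊆ys : ∀ {y} → y ∈ map (to θ) xs → y ∈ ys
    map-to-xs⊆ys y∈ with _ , x∈ , refl ← ∈-map⁻ (to θ) y∈ = complete ys-enum (to-∈ θ (sound xs-enum x∈))

    ys⊆map-to-xs : ∀ {y} → y ∈ ys → y ∈ map (to θ) xs
    ys⊆map-to-xs y∈ = let Qy = sound ys-enum y∈ in
      subst (_∈ map (to θ) xs) (to∘from θ Qy) (∈-map⁺ (to θ) (complete xs-enum (from-∈ θ Qy)))

    map-to-xs↭ys : map (to θ) xs ↭ ys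
    map-to-xs↭ys = ∼bag⇒↭ (unique∧set⇒bag
      (map-to-unique (All.tabulate (sound xs-enum)) (unique xs-enum)) (unique ys-enum)
      (mk⇔ map-to-xs⊆ys ys⊆map-to-xs))

filter-enumerates : {P : Pred A p₁} {Q : Pred A p₂} (Q? : Decidable Q) {xs : List A} →
  xs Enumerates P → filter Q? xs Enumerates P ∩ Q
filter-enumerates Q? {xs} E = record
  { unique   = Unique.filter⁺ Q? (unique E)
  ; sound    = λ x∈ → let x∈xs , Qx = ∈-filter⁻ Q? {xs = xs} x∈ in sound E x∈xs , Qx
  ; complete = λ (Px , Qx) → ∈-filter⁺ Q? (complete E Px) Qx
  }

filter-++-filter-∁-↭ : {P : Pred A p₁} (P? : Decidable P) (xs : List A) →
  filter P? xs ++ filter (∁? P?) xs ↭ xs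
filter-++-filter-∁-↭ P? xs = subst (λ (ys , zs) → ys ++ zs ↭ xs) (List.partition-defn P? xs)
  (↭-sym (↭ₛ⇒↭ (partition-↭ (setoid _) P? xs)))

length-filter-+-∁ : {P : Pred A p₁} {Q : Pred A p₂} (P? : Decidable P) (Q? : Decidable Q) →
  Q ≐ ∁ P → (xs : List A) → length (filter P? xs) + length (filter Q? xs) ≡ length xs
length-filter-+-∁ P? Q? Q≐∁P xs = begin
  length (filter P? xs) + length (filter Q? xs)
    ≡⟨ cong (λ ys → length (filter P? xs) + length ys) (List.filter-≐ Q? (∁? P?) Q≐∁P xs) ⟩
  length (filter P? xs) + length (filter (∁? P?) xs)
    ≡⟨ List.length-++ (filter P? xs) ⟨
  length (filter P? xs ++ filter (∁? P?) xs)
    ≡⟨ ↭-length (filter-++-filter-∁-↭ P? xs) ⟩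
  length xs ∎
  where open ≡-Reasoning

module _ {P : Pred A p₁} (P? : Decidable P) {xs ys : List A} where

  filter-++ˡ : All P xs → All (∁ P) ys → filter P? (xs ++ ys) ≡ xs
  filter-++ˡ Pxs ¬Pys = begin
    filter P? (xs ++ ys)         ≡⟨ List.filter-++ P? xs ys ⟩
    filter P? xs ++ filter P? ys ≡⟨ cong₂ _++_ (List.filter-all P? Pxs) (List.filter-none P? ¬Pys) ⟩
    xs ++ []                     ≡⟨ List.++-identityʳ xs ⟩
    xs                           ∎
    where open ≡-Reasoning

  filter-++ʳ : All (∁ P) xs → All P ys → filter P? (xs ++ ys) ≡ ys
  filter-++ʳ ¬Pxs Pys = trans (List.filter-++ P? xs ys)
    (cong₂ _++_ (List.filter-none P? ¬Pxs) (List.filter-all P? Pys))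

-- The partitions of n − e

listsOfLen-suc : ∀ n k →
  listsOfLen n (suc k) ≡ cartesianProductWith _∷_ (map suc (upTo n)) (listsOfLen n k)
listsOfLen-suc n k = concatMap-map (map suc (upTo n))
  where
  concatMap-map : ∀ xs →
    concatMap (λ x → map (x ∷_) (listsOfLen n k)) xs ≡ cartesianProductWith _∷_ xs (listsOfLen n k)
  concatMap-map []       = refl
  concatMap-map (x ∷ xs) = cong (map (x ∷_) (listsOfLen n k) ++_) (concatMap-map xs)

listsOfLen-unique : ∀ n k → Unique (listsOfLen n k)
listsOfLen-unique n zero    = [] ∷ []
listsOfLen-unique n (suc k) rewrite listsOfLen-suc n k =
  Unique.cartesianProductWith⁺ _∷_ List.∷-injective
    (Unique.map⁺ suc-injective (Unique.upTo⁺ n)) (listsOfLen-unique n k)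

∈-listsOfLen⇒length≡ : ∀ n k {xs} → xs ∈ listsOfLen n k → length xs ≡ k
∈-listsOfLen⇒length≡ n zero    (here refl) = refl
∈-listsOfLen⇒length≡ n (suc k) xs∈ rewrite listsOfLen-suc n k
  with _ , _ , _ , ys∈ , refl ← ∈-cartesianProductWith⁻ _∷_ (map suc (upTo n)) (listsOfLen n k) xs∈
  = cong suc (∈-listsOfLen⇒length≡ n k ys∈)

∈-listsOfLen : ∀ {xs} → All (0 <_) xs → All (_≤ n) xs → xs ∈ listsOfLen n (length xs)
∈-listsOfLen []  [] = here refl
∈-listsOfLen {n} {_ ∷ xs} (z<s ∷ pos) (x≤n ∷ xs≤n) rewrite listsOfLen-suc n (length xs) =
  ∈-cartesianProductWith⁺ _∷_ (∈-map⁺ suc (∈-upTo⁺ x≤n)) (∈-listsOfLen pos xs≤n)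

candidates-unique : ∀ n → Unique (candidates n)
candidates-unique n = Unique.concat⁺
  (All.map⁺ (All.universal (listsOfLen-unique n) (upTo (suc n))))
  (AllPairs.map⁺ (AllPairs.map disjoint (Unique.upTo⁺ (suc n))))
  where
  disjoint : ∀ {i j} → i ≢ j → ∀ {xs} → ¬ (xs ∈ listsOfLen n i × xs ∈ listsOfLen n j)
  disjoint i≢j (xs∈ᵢ , xs∈ⱼ) =
    i≢j (trans (sym (∈-listsOfLen⇒length≡ n _ xs∈ᵢ)) (∈-listsOfLen⇒length≡ n _ xs∈ⱼ))

all≤sum : ∀ xs → All (_≤ sum xs) xs
all≤sum []       = []
all≤sum (x ∷ xs) = m≤m+n x (sum xs) ∷ All.map (λ y≤ → ≤-trans y≤ (m≤n+m (sum xs) x)) (all≤sum xs)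

length≤sum : ∀ {xs} → All (0 <_) xs → length xs ≤ sum xs
length≤sum []          = z≤n
length≤sum (0<x ∷ pos) = +-mono-≤ 0<x (length≤sum pos)

∈-candidates : ∀ {xs} → All (0 <_) xs → sum xs ≤ n → xs ∈ candidates n
∈-candidates {n} {xs} pos sum≤n = ∈-concat⁺′
  (∈-listsOfLen pos (All.map (λ x≤ → ≤-trans x≤ sum≤n) (all≤sum xs)))
  (∈-map⁺ (listsOfLen n) (∈-upTo⁺ (s≤s (≤-trans (length≤sum pos) sum≤n))))

Desc : Pred (List ℕ) 0ℓ
Desc = Linked _≥_

-- Keeping the deficiency e as a parameter makes p(n − e) vanish for e > n, unlike p (n ∸ e).
Partition : (n e : ℕ) → Pred (List ℕ) 0ℓ
Partition n e xs = Desc xs × All (0 <_) xs × sum xs + e ≡ n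

partition? : ∀ n e → Decidable (Partition n e)
partition? n e xs = linked? _≥?_ xs ×-dec All.all? (0 <?_) xs ×-dec (sum xs + e ≟ n)

partitions : (n e : ℕ) → List (List ℕ)
partitions n e = filter (partition? n e) (candidates n)

#partitions : (n e : ℕ) {Q : Pred (List ℕ) 0ℓ} → Decidable Q → ℕ
#partitions n e Q? = length (filter Q? (partitions n e))

filter-candidates-enumerates : ∀ n {P : Pred (List ℕ) 0ℓ} (P? : Decidable P) →
  P ⊆ (_∈ candidates n) → filter P? (candidates n) Enumerates P
filter-candidates-enumerates n P? P⊆ = record
  { unique   = Unique.filter⁺ P? (candidates-unique n)
  ; sound    = proj₂ ∘ ∈-filter⁻ P? {xs = candidates n}
  ; complete = λ Px → ∈-filter⁺ P? (P⊆ Px) Px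
  }

partitions-enumerate : partitions n e Enumerates Partition n e
partitions-enumerate {n} {e} = filter-candidates-enumerates n (partition? n e)
  λ {xs} (_ , pos , size) → ∈-candidates pos (≤-trans (m≤m+n (sum xs) e) (≤-reflexive size))

partitionsWith-enumerate : {Q : Pred (List ℕ) 0ℓ} (Q? : Decidable Q) →
  filter (λ xs → isPartition? n xs ×-dec Q? xs) (candidates n) Enumerates IsPartition n ∩ Q
partitionsWith-enumerate {n} Q? = filter-candidates-enumerates n
  (λ xs → isPartition? n xs ×-dec Q? xs)
  λ ((_ , pos , size) , _) → ∈-candidates pos (≤-reflexive size)

#partitions-≃ : ∀ n {e e′} {Q Q′ : Pred (List ℕ) 0ℓ} (Q? : Decidable Q) (Q′? : Decidable Q′) →
  Partition n e ∩ Q ≃ Partition n e′ ∩ Q′ → #partitions n e Q? ≡ #partitions n e′ Q′?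
#partitions-≃ n Q? Q′? θ = ≃⇒length≡ θ
  (filter-enumerates Q? partitions-enumerate) (filter-enumerates Q′? partitions-enumerate)

#partitions-vanishes : ∀ {Q : Pred (List ℕ) 0ℓ} (Q? : Decidable Q) → n < e → #partitions n e Q? ≡ 0
#partitions-vanishes {n} {e} Q? n<e = cong (length ∘ filter Q?)
  (List.filter-none (partition? n e) (All.universal no-partition (candidates n)))
  where
  no-partition : ∀ xs → ¬ Partition n e xs
  no-partition xs (_ , _ , size) = <⇒≱ n<e (≤-trans (m≤n+m e (sum xs)) (≤-reflexive size))

p≡length-partitions : e ≤ n → p (n ∸ e) ≡ length (partitions n e)
p≡length-partitions {e} {n} e≤n = ≃⇒length≡ (≐⇒≃ (to-partition , from-partition))
  (partitionsWith-enumerate (λ _ → yes tt)) partitions-enumerate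
  where
  to-partition : IsPartition (n ∸ e) ∩ (λ _ → ⊤) ⊆ Partition n e
  to-partition ((desc , pos , size) , _) = desc , pos , trans (cong (_+ e) size) (m∸n+n≡m e≤n)
  from-partition : Partition n e ⊆ IsPartition (n ∸ e) ∩ (λ _ → ⊤)
  from-partition {xs} (desc , pos , size) =
    (desc , pos , trans (sym (m+n∸n≡m (sum xs) e)) (cong (_∸ e) size)) , tt

-- Weakly decreasing lists

≥-decTotalOrder : DecTotalOrder 0ℓ 0ℓ 0ℓ
≥-decTotalOrder = Flip.decTotalOrder ≤-decTotalOrder

open DecTotalOrder ≥-decTotalOrder using () renaming (totalOrder to ≥-totalOrder; trans to ≥-trans)
open import Data.List.Sort.InsertionSort.Base ≥-decTotalOrder using (insert; sort)
open import Data.List.Sort.InsertionSort.Properties ≥-decTotalOrder using (insert-↭; insert-↗; sort-↭; sort-↗)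

desc-head : ∀ {x xs} → Desc (x ∷ xs) → All (_≤ x) xs
desc-head = AllPairs.head ∘ Linked.Linked⇒AllPairs ≥-trans

desc-∷ : ∀ {x xs} → All (_≤ x) xs → Desc xs → Desc (x ∷ xs)
desc-∷ []        []           = [-]
desc-∷ (y≤x ∷ _) [-]          = y≤x ∷ [-]
desc-∷ (y≤x ∷ _) (z≤y ∷ desc) = y≤x ∷ z≤y ∷ desc

desc-↭⇒≡ : ∀ {xs ys} → Desc xs → Desc ys → xs ↭ ys → xs ≡ ys
desc-↭⇒≡ dx dy xs↭ys = Pointwise-≡⇒≡ (Sorted.↗↭↗⇒≋ ≥-totalOrder dx dy (↭⇒↭ₛ xs↭ys))

desc-all-≤ : ∀ {b x xs} → Desc (x ∷ xs) → x ≤ b → All (_≤ b) (x ∷ xs)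
desc-all-≤ desc x≤b = x≤b ∷ All.map (λ y≤x → ≤-trans y≤x x≤b) (desc-head desc)

filter-sort : {P : Pred ℕ p₁} (P? : Decidable P) (xs : List ℕ) {ys : List ℕ} →
  Desc ys → filter P? xs ≡ ys → filter P? (sort xs) ≡ ys
filter-sort P? xs desc eq = desc-↭⇒≡ (Linked.filter⁺ P? ≥-trans (sort-↗ xs)) desc
  (↭-trans (filter-↭ P? (sort-↭ xs)) (↭-reflexive eq))

delete : ℕ → List ℕ → List ℕ
delete x []       = []
delete x (y ∷ ys) with x ≟ y
... | yes _ = ys
... | no  _ = y ∷ delete x ys

delete-↭ : ∀ {x xs} → x ∈ xs → x ∷ delete x xs ↭ xs
delete-↭ {x} {y ∷ ys} x∈ with x ≟ y | x∈
... | yes refl | _         = ↭-refl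
... | no x≢y   | here x≡y  = contradiction x≡y x≢y
... | no x≢y   | there x∈′ = ↭-trans (↭-swap x y ↭-refl) (↭-prep y (delete-↭ x∈′))

delete-all : ∀ {P : Pred ℕ p₁} x {xs} → All P xs → All P (delete x xs)
delete-all x [] = []
delete-all x {y ∷ ys} (Py ∷ Pys) with x ≟ y
... | yes _ = Pys
... | no  _ = Py ∷ delete-all x Pys

delete-desc : ∀ x {xs} → Desc xs → Desc (delete x xs)
delete-desc x {[]} desc = []
delete-desc x {y ∷ ys} desc with x ≟ y
... | yes _ = Linked.tail desc
... | no  _ = desc-∷ (delete-all x (desc-head desc)) (delete-desc x (Linked.tail desc))

∈-delete : ∀ {x y xs} → x ∈ xs → y ≢ x → y ∈ xs → y ∈ delete x xs
∈-delete x∈ y≢x y∈ with ∈-resp-↭ (↭-sym (delete-↭ x∈)) y∈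
... | here y≡x  = contradiction y≡x y≢x
... | there y∈′ = y∈′

delete-insert : ∀ x {xs} → Desc xs → delete x (insert x xs) ≡ xs
delete-insert x {xs} desc = desc-↭⇒≡ (delete-desc x (insert-↗ x desc)) desc
  (drop-∷ (↭-trans (delete-↭ (∈-resp-↭ (↭-sym (insert-↭ x xs)) (here refl))) (insert-↭ x xs)))

insert-delete : ∀ {x xs} → Desc xs → x ∈ xs → insert x (delete x xs) ≡ xs
insert-delete {x} {xs} desc x∈ = desc-↭⇒≡ (insert-↗ x (delete-desc x desc)) desc
  (↭-trans (insert-↭ x (delete x xs)) (delete-↭ x∈))

-- For a weakly decreasing list i₀ ≥ i₁ ≥ … the sequence i_t − t strictly decreases:
-- it either attains k or skips it, where running out of entries counts as skipping.
data Attains : ℕ → List ℕ → Set where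
  equal : ∀ {k is} → Attains k (k ∷ is)
  above : ∀ {k i is} → k < i → Attains (suc k) is → Attains k (i ∷ is)

data Skips : ℕ → List ℕ → Set where
  end   : ∀ {k} → Skips k []
  below : ∀ {k i is} → i < k → Skips k (i ∷ is)
  above : ∀ {k i is} → k < i → Skips (suc k) is → Skips k (i ∷ is)

attains⇒¬skips : ∀ {k is} → Attains k is → ¬ Skips k is
attains⇒¬skips equal             (below k<k)     = <-irrefl refl k<k
attains⇒¬skips equal             (above k<k _)   = <-irrefl refl k<k
attains⇒¬skips (above k<i _)     (below i<k)     = <-asym i<k k<i
attains⇒¬skips (above _ attains) (above _ skips) = attains⇒¬skips attains skips

skips⊎attains : ∀ k is → Skips k is ⊎ Attains k is
skips⊎attains k []       = inj₁ end
skips⊎attains k (i ∷ is) with <-cmp i k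
... | tri< i<k _ _  = inj₁ (below i<k)
... | tri≈ _ refl _ = inj₂ equal
... | tri> _ _ k<i  = Sum.map (above k<i) (above k<i) (skips⊎attains (suc k) is)

¬skips⇒attains : ∀ {k is} → ¬ Skips k is → Attains k is
¬skips⇒attains {k} {is} ¬skips with skips⊎attains k is
... | inj₁ skips   = contradiction skips ¬skips
... | inj₂ attains = attains

skips? : ∀ k → Decidable (Skips k)
skips? k is with skips⊎attains k is
... | inj₁ skips   = yes skips
... | inj₂ attains = no (attains⇒¬skips attains)

attains? : ∀ k → Decidable (Attains k)
attains? k is = map′ ¬skips⇒attains attains⇒¬skips (¬? (skips? k is))

all-<⇒skips : ∀ {k is} → All (_< k) is → Skips k is
all-<⇒skips []        = end
all-<⇒skips (i<k ∷ _) = below i<k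

insert-skips : ∀ {j k is} → j < k → Skips k is → Skips k (insert j is)
insert-skips j<k end = below j<k
insert-skips {j} {is = i ∷ is} j<k (below i<k) with i ≤ᵇ j
... | true  = below j<k
... | false = below i<k
insert-skips {j} {is = i ∷ is} j<k (above k<i skips) with i ≤ᵇ j | ≤ᵇ-reflects-≤ i j
... | true  | ofʸ i≤j = contradiction i≤j (<⇒≱ (<-trans j<k k<i))
... | false | _       = above k<i (insert-skips (m<n⇒m<1+n j<k) skips)

delete-skips : ∀ {j k is} → j < k → Desc is → Skips k is → Skips k (delete j is)
delete-skips j<k desc end = end
delete-skips {j} {is = i ∷ is} j<k desc (below i<k) with j ≟ i
... | yes _ = all-<⇒skips (All.map (λ l≤i → ≤-<-trans l≤i i<k) (desc-head desc))
... | no  _ = below i<k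
delete-skips {j} {is = i ∷ is} j<k desc (above k<i skips) with j ≟ i
... | yes refl = contradiction j<k (<-asym k<i)
... | no  _    = above k<i (delete-skips (m<n⇒m<1+n j<k) (Linked.tail desc) skips)

Contains : ℕ → Pred (List ℕ) 0ℓ
Contains k is = ∀ j → j < k → j ∈ is

insert-≃ : ∀ {k l} → k < l →
  Desc ∩ (Contains k ∩ Skips l) ≃ Desc ∩ (Contains (suc k) ∩ Skips l)
insert-≃ {k} {l} k<l = record
  { to      = insert k
  ; from    = delete k
  ; to-∈    = λ (desc , contains , skips) →
      insert-↗ k desc , contains-insert contains , insert-skips k<l skips
  ; from-∈  = λ (desc , contains , skips) →
      delete-desc k desc ,
      (λ j j<k → ∈-delete (contains k ≤-refl) (<⇒≢ j<k) (contains j (m<n⇒m<1+n j<k))) ,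
      delete-skips k<l desc skips
  ; from∘to = λ (desc , _) → delete-insert k desc
  ; to∘from = λ (desc , contains , _) → insert-delete desc (contains k ≤-refl)
  }
  where
  contains-insert : ∀ {is} → Contains k is → Contains (suc k) (insert k is)
  contains-insert {is} contains j (s≤s j≤k) = ∈-resp-↭ (↭-sym (insert-↭ k is)) j∈k∷is
    where
    j∈k∷is : j ∈ k ∷ is
    j∈k∷is with m≤n⇒m<n∨m≡n j≤k
    ... | inj₁ j<k  = there (contains j j<k)
    ... | inj₂ refl = here refl

lengthen : ℕ → List ℕ → List ℕ
lengthen k []       = []
lengthen k (i ∷ is) with k <? i
... | yes _ = suc i ∷ lengthen (suc k) is
... | no  _ = is

shorten : ℕ → List ℕ → List ℕ
shorten k []       = k ∷ []
shorten k (i ∷ is) with suc k <? i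
... | yes _ = pred i ∷ shorten (suc k) is
... | no  _ = k ∷ i ∷ is

lengthen-above : ∀ {k i} is → k < i → lengthen k (i ∷ is) ≡ suc i ∷ lengthen (suc k) is
lengthen-above {k} {i} is k<i with k <? i
... | yes _   = refl
... | no  k≮i = contradiction k<i k≮i

lengthen-equal : ∀ k is → lengthen k (k ∷ is) ≡ is
lengthen-equal k is with k <? k
... | yes k<k = contradiction k<k (<-irrefl refl)
... | no  _   = refl

shorten-above : ∀ {k i} is → suc k < i → shorten k (i ∷ is) ≡ pred i ∷ shorten (suc k) is
shorten-above {k} {i} is k<i with suc k <? i
... | yes _   = refl
... | no  k≮i = contradiction k<i k≮i

shorten-all-≤ : ∀ {k is} → All (_≤ k) is → shorten k is ≡ k ∷ is
shorten-all-≤ [] = refl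
shorten-all-≤ {k} {i ∷ is} (i≤k ∷ _) with suc k <? i
... | yes k<i = contradiction (m≤n⇒m≤1+n i≤k) (<⇒≱ k<i)
... | no  _   = refl

lengthen-≤ : ∀ {k b is} → All (_≤ b) is → All (_≤ suc b) (lengthen k is)
lengthen-≤ [] = []
lengthen-≤ {k} {is = i ∷ is} (i≤b ∷ is≤b) with k <? i
... | yes _ = s≤s i≤b ∷ lengthen-≤ is≤b
... | no  _ = All.map m≤n⇒m≤1+n is≤b

lengthen-desc : ∀ {k is} → Desc is → Desc (lengthen k is)
lengthen-desc {is = []} desc = []
lengthen-desc {k} {i ∷ is} desc with k <? i
... | yes _ = desc-∷ (lengthen-≤ (desc-head desc)) (lengthen-desc (Linked.tail desc))
... | no  _ = Linked.tail desc

lengthen-skips : ∀ {k is} → Desc is → Attains k is → Skips (suc k) (lengthen k is)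
lengthen-skips {k} {_ ∷ is} desc equal rewrite lengthen-equal k is =
  all-<⇒skips (All.map s≤s (desc-head desc))
lengthen-skips {is = _ ∷ is} desc (above k<i attains) rewrite lengthen-above is k<i =
  above (s≤s k<i) (lengthen-skips (Linked.tail desc) attains)

shorten-≤ : ∀ {k b is} → k ≤ b → All (_≤ suc b) is → Desc is → Skips (suc k) is →
  All (_≤ b) (shorten k is)
shorten-≤ k≤b _ desc end = k≤b ∷ []
shorten-≤ k≤b _ desc (below (s≤s i≤k)) rewrite shorten-all-≤ (desc-all-≤ desc i≤k) =
  k≤b ∷ desc-all-≤ desc (≤-trans i≤k k≤b)
shorten-≤ {is = suc i ∷ is} k≤b (s≤s i≤b ∷ is≤b) desc (above k<i skips)
  rewrite shorten-above is k<i =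
  i≤b ∷ shorten-≤ (≤-trans (s≤s⁻¹ k<i) i≤b) is≤b (Linked.tail desc) skips

shorten-desc : ∀ {k is} → Desc is → Skips (suc k) is → Desc (shorten k is)
shorten-desc desc end = [-]
shorten-desc desc (below (s≤s i≤k)) rewrite shorten-all-≤ (desc-all-≤ desc i≤k) = i≤k ∷ desc
shorten-desc {is = suc i ∷ is} desc (above k<i skips) rewrite shorten-above is k<i =
  desc-∷ (shorten-≤ (s≤s⁻¹ k<i) (desc-head desc) (Linked.tail desc) skips)
         (shorten-desc (Linked.tail desc) skips)

shorten-attains : ∀ {k is} → Desc is → Skips (suc k) is → Attains k (shorten k is)
shorten-attains desc end = equal
shorten-attains desc (below (s≤s i≤k)) rewrite shorten-all-≤ (desc-all-≤ desc i≤k) = equal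
shorten-attains {is = suc i ∷ is} desc (above k<i skips) rewrite shorten-above is k<i =
  above (s≤s⁻¹ k<i) (shorten-attains (Linked.tail desc) skips)

shorten-lengthen : ∀ {k is} → Desc is → Attains k is → shorten k (lengthen k is) ≡ is
shorten-lengthen {k} {_ ∷ is} desc equal rewrite lengthen-equal k is = shorten-all-≤ (desc-head desc)
shorten-lengthen {k} {i ∷ is} desc (above k<i attains)
  rewrite lengthen-above is k<i | shorten-above (lengthen (suc k) is) (s≤s k<i) =
  cong (i ∷_) (shorten-lengthen (Linked.tail desc) attains)

lengthen-shorten : ∀ {k is} → Desc is → Skips (suc k) is → lengthen k (shorten k is) ≡ is
lengthen-shorten {k} desc end = lengthen-equal k []
lengthen-shorten {k} {is} desc (below (s≤s i≤k)) rewrite shorten-all-≤ (desc-all-≤ desc i≤k) =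
  lengthen-equal k is
lengthen-shorten {k} {suc i ∷ is} desc (above k<i skips)
  rewrite shorten-above is k<i | lengthen-above (shorten (suc k) is) (s≤s⁻¹ k<i) =
  cong (suc i ∷_) (lengthen-shorten (Linked.tail desc) skips)

lengthen-≃ : ∀ k → Desc ∩ Attains k ≃ Desc ∩ Skips (suc k)
lengthen-≃ k = record
  { to      = lengthen k
  ; from    = shorten k
  ; to-∈    = λ (desc , attains) → lengthen-desc desc , lengthen-skips desc attains
  ; from-∈  = λ (desc , skips) → shorten-desc desc skips , shorten-attains desc skips
  ; from∘to = λ (desc , attains) → shorten-lengthen desc attains
  ; to∘from = λ (desc , skips) → lengthen-shorten desc skips
  }

-- Durfee rectangles

at-≤ : ∀ {c ls} j → All (_≤ c) ls → at ls j ≤ c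
at-≤ j       []         = z≤n
at-≤ zero    (l≤c ∷ _)  = l≤c
at-≤ (suc j) (_ ∷ ls≤c) = at-≤ j ls≤c

durfeeAux-≤ : ∀ {c ls} j → All (_≤ c) ls → durfeeAux ls c j ≡ 0
durfeeAux-≤ zero ls≤c = refl
durfeeAux-≤ {c} {ls} (suc j) ls≤c with suc j + c ≤? at ls j
... | yes fits = contradiction (≤-trans fits (at-≤ j ls≤c)) (<⇒≱ (s≤s (m≤n+m c j)))
... | no  _    = durfeeAux-≤ j ls≤c

durfeeAux-∷ : ∀ {c l} ls j → c < l → durfeeAux (l ∷ ls) c (suc j) ≡ suc (durfeeAux ls (suc c) j)
durfeeAux-∷ {c} {l} ls zero c<l with suc c ≤? l
... | yes _   = refl
... | no  c≮l = contradiction c<l c≮l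
durfeeAux-∷ {c} ls (suc j) c<l with 2+ j + c ≤? at ls j | suc j + suc c ≤? at ls j
... | yes _    | yes _    = refl
... | no  _    | no  _    = durfeeAux-∷ ls j c<l
... | yes fits | no ¬fits = contradiction (subst (λ b → suc b ≤ at ls j) (sym (+-suc j c)) fits) ¬fits
... | no ¬fits | yes fits = contradiction (subst (λ b → suc b ≤ at ls j) (+-suc j c) fits) ¬fits

durfee : ℕ → List ℕ → ℕ
durfee c ls = durfeeAux ls c (length ls)

BelowDurfee : ℕ → Pred (List ℕ) 0ℓ
BelowDurfee c ls = All (_< durfee c ls + c) (drop (durfee c ls) ls)

durfee-∷ : ∀ {c l} ls → c < l → durfee c (l ∷ ls) ≡ suc (durfee (suc c) ls)
durfee-∷ ls = durfeeAux-∷ ls (length ls)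

belowDurfee-∷ : ∀ {c l} ls → c < l → BelowDurfee c (l ∷ ls) ≡ BelowDurfee (suc c) ls
belowDurfee-∷ {c} ls c<l rewrite durfee-∷ ls c<l =
  cong (λ b → All (_< b) (drop (durfee (suc c) ls) ls)) (sym (+-suc (durfee (suc c) ls) c))

belowDurfee-all-≤ : ∀ {c ls} → All (_≤ c) ls → BelowDurfee c ls ≡ All (_< c) ls
belowDurfee-all-≤ {ls = ls} ls≤c rewrite durfeeAux-≤ (length ls) ls≤c = refl

belowDurfee⇒skips : ∀ {k is} → Desc is → BelowDurfee (suc k) (map suc is) → Skips k is
belowDurfee⇒skips {is = []} desc below-durfee = end
belowDurfee⇒skips {k} {i ∷ is} desc below-durfee with k <? i
... | yes k<i = above k<i (belowDurfee⇒skips (Linked.tail desc)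
                  (subst id (belowDurfee-∷ (map suc is) (s≤s k<i)) below-durfee))
... | no  k≮i = all-<⇒skips (All.map s≤s⁻¹ (All.map⁻
                  (subst id (belowDurfee-all-≤ 1+is≤1+k) below-durfee)))
  where
  1+is≤1+k : All (_≤ suc k) (map suc (i ∷ is))
  1+is≤1+k = All.map⁺ (All.map s≤s (desc-all-≤ desc (≮⇒≥ k≮i)))

skips⇒belowDurfee : ∀ {k is} → Desc is → Skips k is → BelowDurfee (suc k) (map suc is)
skips⇒belowDurfee desc end = []
skips⇒belowDurfee {k} {i ∷ is} desc (below i<k) =
  subst id (sym (belowDurfee-all-≤ (All.map <⇒≤ 1+is<1+k))) 1+is<1+k
  where
  1+is<1+k : All (_< suc k) (map suc (i ∷ is))
  1+is<1+k = All.map⁺ (All.map (λ j≤i → s<s (≤-<-trans j≤i i<k)) (desc-all-≤ desc ≤-refl))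
skips⇒belowDurfee {is = _ ∷ is} desc (above k<i skips) =
  subst id (sym (belowDurfee-∷ (map suc is) (s≤s k<i))) (skips⇒belowDurfee (Linked.tail desc) skips)

-- Partitions by the parts in a residue class

module Residue (a m : ℕ) .{{_ : NonZero m}} (0<a : 0 < a) (a<m : a < m) where

  part : ℕ → ℕ
  part i = a + m * i

  index : ℕ → ℕ
  index x = (x ∸ a) / m

  0<part : ∀ i → 0 < part i
  0<part i = <-≤-trans 0<a (m≤m+n a (m * i))

  part-≡a : ∀ i → part i ≡[ m ] a
  part-≡a i = trans (cong (λ s → (a + s) % m) (*-comm m i)) ([m+kn]%n≡m%n a i m)

  index-part : ∀ i → index (part i) ≡ i
  index-part i = begin
    (a + m * i ∸ a) / m ≡⟨ cong (_/ m) (m+n∸m≡n a (m * i)) ⟩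
    m * i / m           ≡⟨ cong (_/ m) (*-comm m i) ⟩
    i * m / m           ≡⟨ m*n/n≡m i m ⟩
    i                   ∎
    where open ≡-Reasoning

  part-index : ∀ {x} → x ≡[ m ] a → part (index x) ≡ x
  part-index {x} x≡a = begin
    part (index x)              ≡⟨ cong (part ∘ index) x≡part ⟩
    part (index (part (x / m))) ≡⟨ cong part (index-part (x / m)) ⟩
    part (x / m)                ≡⟨ x≡part ⟨
    x                           ∎
    where
    open ≡-Reasoning
    x≡part : x ≡ part (x / m)
    x≡part = trans (m≡m%n+[m/n]*n x m)
      (cong₂ _+_ (trans x≡a (m<n⇒m%n≡m a<m)) (*-comm (x / m) m))

  ≡a? : Decidable (_≡[ m ] a)
  ≡a? x = x % m ≟ a % m

  indices : List ℕ → List ℕ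
  indices = map index ∘ partsCong a m

  rest : List ℕ → List ℕ
  rest = partsNotCong a m

  map-part-indices : ∀ xs → map part (indices xs) ≡ partsCong a m xs
  map-part-indices xs = trans (sym (List.map-∘ (partsCong a m xs)))
    (List.map-id-local (All.map part-index (All.all-filter ≡a? xs)))

  indices-desc : ∀ {xs} → Desc xs → Desc (indices xs)
  indices-desc desc = Linked.map⁺ (Linked.map (λ y≤x → /-monoˡ-≤ m (∸-monoˡ-≤ a y≤x))
    (Linked.filter⁺ ≡a? ≥-trans desc))

  parts-≡a : ∀ is → All (_≡[ m ] a) (map part is)
  parts-≡a is = All.map⁺ (All.universal part-≡a is)

  compose : List ℕ × List ℕ → List ℕ
  compose (is , ns) = sort (map part is ++ ns)

  sum-compose : ∀ is ns → sum (compose (is , ns)) ≡ sum (map part is) + sum ns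
  sum-compose is ns = trans (sum-↭ (sort-↭ (map part is ++ ns))) (sum-++ (map part is) ns)

  compose-indices-rest : ∀ {xs} → Desc xs → compose (indices xs , rest xs) ≡ xs
  compose-indices-rest {xs} desc rewrite map-part-indices xs =
    desc-↭⇒≡ (sort-↗ (partsCong a m xs ++ rest xs)) desc
      (↭-trans (sort-↭ (partsCong a m xs ++ rest xs)) (filter-++-filter-∁-↭ ≡a? xs))

  indices-compose : ∀ is ns → Desc is → All (∁ (_≡[ m ] a)) ns → indices (compose (is , ns)) ≡ is
  indices-compose is ns desc ns≢a = begin
    map index (partsCong a m (compose (is , ns)))
      ≡⟨ cong (map index) (filter-sort ≡a? (map part is ++ ns) parts-desc
           (filter-++ˡ ≡a? (parts-≡a is) ns≢a)) ⟩
    map index (map part is) ≡⟨ List.map-∘ is ⟨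
    map (index ∘ part) is   ≡⟨ List.map-cong index-part is ⟩
    map id is               ≡⟨ List.map-id is ⟩
    is                      ∎
    where
    open ≡-Reasoning
    parts-desc : Desc (map part is)
    parts-desc = Linked.map⁺ (Linked.map (λ j≤i → +-monoʳ-≤ a (*-monoʳ-≤ m j≤i)) desc)

  rest-compose : ∀ is ns → Desc ns → All (∁ (_≡[ m ] a)) ns → rest (compose (is , ns)) ≡ ns
  rest-compose is ns desc ns≢a = filter-sort (∁? ≡a?) (map part is ++ ns) desc
    (filter-++ʳ (∁? ≡a?) (All.map (λ x≡a x≢a → x≢a x≡a) (parts-≡a is)) ns≢a)

  Decomposition : (n e : ℕ) → Pred (List ℕ × List ℕ) 0ℓ
  Decomposition n e (is , ns) = Desc is × (Desc ns × All (0 <_) ns × All (∁ (_≡[ m ] a)) ns) ×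
    sum (map part is) + sum ns + e ≡ n

  decompose-≃ : Partition n e ≃ Decomposition n e
  decompose-≃ {n} {e} = record
    { to      = λ xs → indices xs , rest xs
    ; from    = compose
    ; to-∈    = λ {xs} (desc , pos , size) →
        indices-desc desc ,
        (Linked.filter⁺ (∁? ≡a?) ≥-trans desc , All.filter⁺ (∁? ≡a?) pos , All.all-filter (∁? ≡a?) xs) ,
        trans (cong (_+ e) (sum-indices-rest desc)) size
    ; from-∈  = λ { {is , ns} (_ , (_ , pos , _) , size) →
        sort-↗ (map part is ++ ns) ,
        All-resp-↭ (↭-sym (sort-↭ _)) (All.++⁺ (All.map⁺ (All.universal 0<part is)) pos) ,
        trans (cong (_+ e) (sum-compose is ns)) size }
    ; from∘to = λ (desc , _) → compose-indices-rest desc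
    ; to∘from = λ { {is , ns} (is-desc , (ns-desc , _ , ns≢a) , _) →
        cong₂ _,_ (indices-compose is ns is-desc ns≢a) (rest-compose is ns ns-desc ns≢a) }
    }
    where
    sum-indices-rest : ∀ {xs} → Desc xs → sum (map part (indices xs)) + sum (rest xs) ≡ sum xs
    sum-indices-rest {xs} desc =
      trans (sym (sum-compose (indices xs) (rest xs))) (cong sum (compose-indices-rest desc))

  module _ {Q Q′ : Pred (List ℕ) 0ℓ} (θ : Desc ∩ Q ≃ Desc ∩ Q′)
    (size≡ : ∀ {is} → Desc is → Q is → sum (map part (to θ is)) + e′ ≡ sum (map part is) + e) where

    decomposition-map₁-≃ : Decomposition n e ∩ proj₁ ⊢ Q ≃ Decomposition n e′ ∩ proj₁ ⊢ Q′
    decomposition-map₁-≃ {n} = record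
      { to      = map₁ (to θ)
      ; from    = map₁ (from θ)
      ; to-∈    = λ { {is , ns} ((desc , ns-ok , size) , Qis) →
          let desc′ , Q′is′ = to-∈ θ (desc , Qis) in
          (desc′ , ns-ok , trans (total≡ (desc , Qis) (sum ns)) size) , Q′is′ }
      ; from-∈  = λ { {is , ns} ((desc , ns-ok , size) , Q′is) →
          let desc′ , Qis′ = from-∈ θ (desc , Q′is) in
          (desc′ , ns-ok , (begin
            sum (map part (from θ is)) + sum ns + e         ≡⟨ total≡ (desc′ , Qis′) (sum ns) ⟨
            sum (map part (to θ (from θ is))) + sum ns + e′ ≡⟨ cong (λ js → sum (map part js) + sum ns + e′)
                                                                 (to∘from θ (desc , Q′is)) ⟩
            sum (map part is) + sum ns + e′                 ≡⟨ size ⟩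
            n                                               ∎)) , Qis′ }
      ; from∘to = λ ((desc , _) , Qis) → cong (_, _) (from∘to θ (desc , Qis))
      ; to∘from = λ ((desc , _) , Q′is) → cong (_, _) (to∘from θ (desc , Q′is))
      }
      where
      open ≡-Reasoning
      comm : ∀ x s e → x + s + e ≡ x + e + s
      comm = solve-∀
      total≡ : ∀ {is} → (Desc ∩ Q) is → ∀ s →
        sum (map part (to θ is)) + s + e′ ≡ sum (map part is) + s + e
      total≡ {is} (desc , Qis) s = begin
        sum (map part (to θ is)) + s + e′ ≡⟨ comm _ s e′ ⟩
        sum (map part (to θ is)) + e′ + s ≡⟨ cong (_+ s) (size≡ desc Qis) ⟩
        sum (map part is) + e + s         ≡⟨ comm _ e s ⟩
        sum (map part is) + s + e         ∎

    indices-≃ : Partition n e ∩ indices ⊢ Q ≃ Partition n e′ ∩ indices ⊢ Q′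
    indices-≃ = ≃-trans decompose-∩-≃ (≃-trans decomposition-map₁-≃ (≃-sym decompose-∩-≃))
      where
      decompose-∩-≃ : ∀ {e} {R : Pred (List ℕ) 0ℓ} →
        Partition n e ∩ indices ⊢ R ≃ Decomposition n e ∩ proj₁ ⊢ R
      decompose-∩-≃ = ≃-∩ decompose-≃ (λ _ → ⇔-id _)

  staircase : ℕ → ℕ
  staircase zero    = 0
  staircase (suc k) = staircase k + part k

  k≤staircase : ∀ k → k ≤ staircase k
  k≤staircase zero    = z≤n
  k≤staircase (suc k) = ≤-trans (≤-reflexive (+-comm 1 k)) (+-mono-≤ (k≤staircase k) (0<part k))

  staircase*2 : ∀ k → staircase k * 2 + m * k ≡ k * (2 * a + m * k)
  staircase*2 zero    = *-zeroʳ m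
  staircase*2 (suc k) = begin
    (staircase k + (a + m * k)) * 2 + m * suc k
      ≡⟨ expand (staircase k) a m k ⟩
    (staircase k * 2 + m * k) + (2 * a + m + 2 * (m * k))
      ≡⟨ cong (_+ (2 * a + m + 2 * (m * k))) (staircase*2 k) ⟩
    k * (2 * a + m * k) + (2 * a + m + 2 * (m * k))
      ≡⟨ collect a m k ⟩
    suc k * (2 * a + m * suc k) ∎
    where
    open ≡-Reasoning
    expand : ∀ s a m k →
      (s + (a + m * k)) * 2 + m * suc k ≡ (s * 2 + m * k) + (2 * a + m + 2 * (m * k))
    expand = solve-∀
    collect : ∀ a m k →
      k * (2 * a + m * k) + (2 * a + m + 2 * (m * k)) ≡ suc k * (2 * a + m * suc k)
    collect = solve-∀

  #skipping : (n k : ℕ) → ℕ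
  #skipping n k = #partitions n (staircase k) (skips? k ∘ indices)

  #skipping-vanishes : ∀ {k} → n < k → #skipping n k ≡ 0
  #skipping-vanishes {k = k} n<k =
    #partitions-vanishes (skips? k ∘ indices) (<-≤-trans n<k (k≤staircase k))

  sum-lengthen : ∀ {k is} → Attains k is → sum (map part (lengthen k is)) + part k ≡ sum (map part is)
  sum-lengthen {k} {_ ∷ is} equal rewrite lengthen-equal k is = +-comm (sum (map part is)) (part k)
  sum-lengthen {k} {i ∷ is} (above k<i attains) rewrite lengthen-above is k<i = begin
    part (suc i) + s + part k   ≡⟨ shift a m i s k ⟩
    part i + (s + part (suc k)) ≡⟨ cong (part i +_) (sum-lengthen attains) ⟩
    part i + sum (map part is)  ∎
    where
    open ≡-Reasoning
    s = sum (map part (lengthen (suc k) is))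
    shift : ∀ a m i s k → a + m * suc i + s + (a + m * k) ≡ a + m * i + (s + (a + m * suc k))
    shift = solve-∀

  #attaining≡#skipping-suc : ∀ n k →
    #partitions n (staircase k) (attains? k ∘ indices) ≡ #skipping n (suc k)
  #attaining≡#skipping-suc n k = #partitions-≃ n (attains? k ∘ indices) (skips? (suc k) ∘ indices)
    (indices-≃ (lengthen-≃ k) size≡)
    where
    size≡ : ∀ {is} → Desc is → Attains k is →
      sum (map part (lengthen k is)) + staircase (suc k) ≡ sum (map part is) + staircase k
    size≡ {is} _ attains = begin
      s + (staircase k + part k)      ≡⟨ shift s (staircase k) (part k) ⟩
      s + part k + staircase k        ≡⟨ cong (_+ staircase k) (sum-lengthen attains) ⟩
      sum (map part is) + staircase k ∎
      where
      open ≡-Reasoning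
      s = sum (map part (lengthen k is))
      shift : ∀ x y z → x + (y + z) ≡ x + z + y
      shift = solve-∀

  #skipping-recurrence : ∀ n k →
    #skipping n k + #skipping n (suc k) ≡ length (partitions n (staircase k))
  #skipping-recurrence n k = begin
    #skipping n k + #skipping n (suc k)
      ≡⟨ cong (#skipping n k +_) (#attaining≡#skipping-suc n k) ⟨
    #skipping n k + #partitions n (staircase k) (attains? k ∘ indices)
      ≡⟨ length-filter-+-∁ (skips? k ∘ indices) (attains? k ∘ indices)
           (attains⇒¬skips , ¬skips⇒attains) (partitions n (staircase k)) ⟩
    length (partitions n (staircase k)) ∎
    where open ≡-Reasoning

  p-recurrence : ∀ n k → staircase k ≤ n →
    p (n ∸ staircase k) ≡ #skipping n k + #skipping n (suc k)
  p-recurrence n k staircase≤n =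
    trans (p≡length-partitions staircase≤n) (sym (#skipping-recurrence n k))

  insert-staircase-≃ : ∀ {k l} → k ≤ l → e ≡ staircase k + e′ →
    Partition n e ∩ indices ⊢ Skips l ≃ Partition n e′ ∩ indices ⊢ (Contains k ∩ Skips l)
  insert-staircase-≃ {k = zero} _ refl = ≐⇒≃
    ((λ (P , skips) → P , (λ _ ()) , skips) , (λ (P , _ , skips) → P , skips))
  insert-staircase-≃ {e} {e′} {k = suc k} k<l e≡ = ≃-trans
    (insert-staircase-≃ (<⇒≤ k<l) (trans e≡ (+-assoc (staircase k) (part k) e′)))
    (indices-≃ (insert-≃ k<l) (λ {is} _ _ → size≡ is))
    where
    size≡ : ∀ is → sum (map part (insert k is)) + e′ ≡ sum (map part is) + (part k + e′)
    size≡ is = trans (cong (_+ e′) (sum-↭ (↭.map⁺ part (insert-↭ k is))))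
      (shift (part k) (sum (map part is)) e′)
      where
      shift : ∀ x y z → x + y + z ≡ y + (x + z)
      shift = solve-∀

  rowLengths≡map-suc-indices : ∀ xs → rowLengths a m (partsCong a m xs) ≡ map suc (indices xs)
  rowLengths≡map-suc-indices xs = trans
    (List.map-cong (λ x → +-comm (index x) 1) (partsCong a m xs))
    (List.map-∘ (partsCong a m xs))

  belowDurfee-rowLengths : ∀ ν xs → let ls = rowLengths a m (partsCong a m xs) in
    All (_< durfeeHeight ν ls + ν + 2) (drop (durfeeHeight ν ls) ls) ≡
    BelowDurfee (2 + ν) (map suc (indices xs))
  belowDurfee-rowLengths ν xs = trans
    (cong (λ b → All (_< b) (drop (durfeeHeight ν ls) ls)) (+-assoc (durfeeHeight ν ls) ν 2))
    (cong₂ BelowDurfee (+-comm ν 2) (rowLengths≡map-suc-indices xs))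
    where ls = rowLengths a m (partsCong a m xs)

  pCond-≐ : ∀ ν n →
    IsPartition n ∩ PCond a m ν n ≐ Partition n 0 ∩ indices ⊢ (Contains (suc ν) ∩ Skips (suc ν))
  pCond-≐ ν n = pCond⇒contains∩skips , contains∩skips⇒pCond
    where
    pCond⇒contains∩skips :
      IsPartition n ∩ PCond a m ν n ⊆ Partition n 0 ∩ indices ⊢ (Contains (suc ν) ∩ Skips (suc ν))
    pCond⇒contains∩skips {xs} ((desc , pos , size) , (_ , _ , present , below-durfee)) =
      (desc , pos , trans (+-identityʳ (sum xs)) size) ,
      (λ j j≤ν → subst (_∈ indices xs) (index-part j)
        (∈-map⁺ index (All.lookup present (∈-upTo⁺ j≤ν)))) ,
      belowDurfee⇒skips (indices-desc desc) (subst id (belowDurfee-rowLengths ν xs) below-durfee)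

    contains∩skips⇒pCond :
      Partition n 0 ∩ indices ⊢ (Contains (suc ν) ∩ Skips (suc ν)) ⊆ IsPartition n ∩ PCond a m ν n
    contains∩skips⇒pCond {xs} ((desc , pos , size) , contains , skips) =
      (desc , pos , sum≡n) ,
      (Linked.filter⁺ ≡a? ≥-trans desc , All.filter⁺ ≡a? pos , sum-partsCong) ,
      All.all-filter ≡a? xs ,
      All.tabulate (λ {j} j∈ → subst (part j ∈_) (map-part-indices xs)
        (∈-map⁺ part (contains j (∈-upTo⁻ j∈)))) ,
      subst id (sym (belowDurfee-rowLengths ν xs)) (skips⇒belowDurfee (indices-desc desc) skips)
      where
      sum≡n : sum xs ≡ n
      sum≡n = trans (sym (+-identityʳ (sum xs))) size
      sum-partsCong : sum (partsCong a m xs) ≡ n ∸ sum (rest xs)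
      sum-partsCong = begin
        sum (partsCong a m xs)
          ≡⟨ m+n∸n≡m (sum (partsCong a m xs)) (sum (rest xs)) ⟨
        sum (partsCong a m xs) + sum (rest xs) ∸ sum (rest xs)
          ≡⟨ cong (_∸ sum (rest xs)) (sum-++ (partsCong a m xs) (rest xs)) ⟨
        sum (partsCong a m xs ++ rest xs) ∸ sum (rest xs)
          ≡⟨ cong (_∸ sum (rest xs)) (trans (sum-↭ (filter-++-filter-∁-↭ ≡a? xs)) sum≡n) ⟩
        n ∸ sum (rest xs) ∎
        where open ≡-Reasoning

  pν≡#skipping : ∀ ν n → pν a m ν n ≡ #skipping n (suc ν)
  pν≡#skipping ν n = ≃⇒length≡
    (≃-trans (≐⇒≃ (pCond-≐ ν n))
      (≃-sym (insert-staircase-≃ ≤-refl (sym (+-identityʳ (staircase (suc ν)))))))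
    (partitionsWith-enumerate (PCond? a m ν n))
    (filter-enumerates (skips? (suc ν) ∘ indices) partitions-enumerate)

open import Data.Integer as ℤ using (ℤ; +_; -[1+_]; ∣_∣; +≤+; 0ℤ; 1ℤ; -1ℤ; -_; _-_; _^_) renaming (_+_ to _+ℤ_; _*_ to _*ℤ_; _≤_ to _≤ℤ_; _≤?_ to _≤ℤ?_)
import Data.Integer.Properties as ℤ
import Data.Integer.Tactic.RingSolver as ℤSolver

-- Dyson's map

positives : List ℕ → List ℕ
positives = filter (0 <?_)

positives-all-≤0 : ∀ {xs} → All (_≤ 0) xs → positives xs ≡ []
positives-all-≤0 xs≤0 = List.filter-none (0 <?_) (All.map ≤⇒≯ xs≤0)

largest : List ℕ → ℕ
largest xs = at xs 0

largest-positives : ∀ {xs} → Desc xs → largest (positives xs) ≡ largest xs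
largest-positives {[]}         desc = refl
largest-positives {zero ∷ xs}  desc rewrite positives-all-≤0 (desc-head desc) = refl
largest-positives {suc x ∷ xs} desc = refl

all-≤-largest : ∀ {xs} → Desc xs → All (_≤ largest xs) xs
all-≤-largest {[]}     desc = []
all-≤-largest {x ∷ xs} desc = desc-all-≤ desc ≤-refl

sum-map-suc : ∀ xs → sum (map suc xs) ≡ sum xs + length xs
sum-map-suc []       = refl
sum-map-suc (x ∷ xs) = trans (cong (λ s → suc x + s) (sum-map-suc xs)) (shift x (sum xs) (length xs))
  where
  shift : ∀ x s l → suc x + (s + l) ≡ x + s + suc l
  shift = solve-∀

sum-replicate-1 : ∀ k → sum (replicate k 1) ≡ k
sum-replicate-1 zero    = refl
sum-replicate-1 (suc k) = cong suc (sum-replicate-1 k)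

desc-++-replicate-1 : ∀ {xs} k → Desc xs → All (0 <_) xs → Desc (xs ++ replicate k 1)
desc-++-replicate-1 zero          desc [] = []
desc-++-replicate-1 (suc zero)    desc [] = [-]
desc-++-replicate-1 (suc (suc k)) desc [] = ≤-refl ∷ desc-++-replicate-1 (suc k) [] []
desc-++-replicate-1 k desc (0<x ∷ pos) =
  desc-∷ (All.++⁺ (desc-head desc) (All.replicate⁺ k 0<x))
         (desc-++-replicate-1 k (Linked.tail desc) pos)

map-pred-desc : ∀ {xs} → Desc xs → Desc (map pred xs)
map-pred-desc = Linked.map⁺ ∘ Linked.map pred-mono-≤

-- (b , μ) is a partition cut into its first row or column, of length b, and the remaining
-- partition μ.  For rows f is the largest part, for columns the number of parts.
Bordered : (f : List ℕ → ℕ) (n e : ℕ) → Pred (ℕ × List ℕ) 0ℓ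
Bordered f n e (b , μ) = Desc μ × All (0 <_) μ × f μ ≤ b × sum μ + b + e ≡ n

removeColumn : List ℕ → ℕ × List ℕ
removeColumn xs = length xs , positives (map pred xs)

addColumn : ℕ × List ℕ → List ℕ
addColumn (t , μ) = map suc μ ++ replicate (t ∸ length μ) 1

addColumn-removeColumn : ∀ {xs} → Desc xs → All (0 <_) xs → addColumn (removeColumn xs) ≡ xs
addColumn-removeColumn {[]} _ [] = refl
addColumn-removeColumn {2+ x ∷ xs} desc (_ ∷ pos) =
  cong (2+ x ∷_) (addColumn-removeColumn (Linked.tail desc) pos)
addColumn-removeColumn {suc zero ∷ xs} desc (_ ∷ pos)
  with positives (map pred xs)
     | positives-all-≤0 (All.map⁺ {f = pred} (All.map pred-mono-≤ (desc-head desc)))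
     | addColumn-removeColumn (Linked.tail desc) pos
... | .[] | refl | ih = cong (1 ∷_) ih

removeColumn-addColumn : ∀ {t μ} → All (0 <_) μ → length μ ≤ t →
  removeColumn (addColumn (t , μ)) ≡ (t , μ)
removeColumn-addColumn {t} {μ} pos len≤t =
  cong₂ _,_ length-addColumn (positives-map-pred k pos)
  where
  k = t ∸ length μ

  length-addColumn : length (addColumn (t , μ)) ≡ t
  length-addColumn = begin
    length (map suc μ ++ replicate k 1)
      ≡⟨ List.length-++ (map suc μ) ⟩
    length (map suc μ) + length (replicate k 1)
      ≡⟨ cong₂ _+_ (List.length-map suc μ) (List.length-replicate k) ⟩
    length μ + k
      ≡⟨ m+[n∸m]≡n len≤t ⟩
    t ∎
    where open ≡-Reasoning

  positives-map-pred : ∀ {μ} k → All (0 <_) μ →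
    positives (map pred (map suc μ ++ replicate k 1)) ≡ μ
  positives-map-pred zero    []          = refl
  positives-map-pred (suc k) []          = positives-map-pred k []
  positives-map-pred k       (z<s ∷ pos) = cong (_ ∷_) (positives-map-pred k pos)

sum-addColumn : ∀ {t} μ → length μ ≤ t → sum (addColumn (t , μ)) ≡ sum μ + t
sum-addColumn {t} μ len≤t = begin
  sum (map suc μ ++ replicate k 1)      ≡⟨ sum-++ (map suc μ) (replicate k 1) ⟩
  sum (map suc μ) + sum (replicate k 1) ≡⟨ cong₂ _+_ (sum-map-suc μ) (sum-replicate-1 k) ⟩
  sum μ + length μ + k                  ≡⟨ +-assoc (sum μ) (length μ) k ⟩
  sum μ + (length μ + k)                ≡⟨ cong (λ l → sum μ + l) (m+[n∸m]≡n len≤t) ⟩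
  sum μ + t                             ∎
  where
  open ≡-Reasoning
  k = t ∸ length μ

removeColumn-≃ : Partition n e ≃ Bordered length n e
removeColumn-≃ {n} {e} = record
  { to      = removeColumn
  ; from    = addColumn
  ; to-∈    = λ {xs} (desc , pos , size) →
      Linked.filter⁺ (0 <?_) ≥-trans (map-pred-desc desc) ,
      All.all-filter (0 <?_) (map pred xs) ,
      length-μ≤length xs ,
      trans (cong (_+ e) (sum-removeColumn desc pos)) size
  ; from-∈  = λ { {t , μ} (desc , _ , len≤t , size) →
      let pos = All.map⁺ (All.universal (λ _ → z<s) μ) in
      desc-++-replicate-1 (t ∸ length μ) (Linked.map⁺ (Linked.map s≤s desc)) pos ,
      All.++⁺ pos (All.replicate⁺ (t ∸ length μ) z<s) ,
      trans (cong (_+ e) (sum-addColumn μ len≤t)) size }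
  ; from∘to = λ (desc , pos , _) → addColumn-removeColumn desc pos
  ; to∘from = λ (_ , pos , len≤t , _) → removeColumn-addColumn pos len≤t
  }
  where
  length-μ≤length : ∀ xs → length (positives (map pred xs)) ≤ length xs
  length-μ≤length xs = ≤-trans (List.length-filter (0 <?_) (map pred xs))
    (≤-reflexive (List.length-map pred xs))

  sum-removeColumn : ∀ {xs} → Desc xs → All (0 <_) xs →
    sum (positives (map pred xs)) + length xs ≡ sum xs
  sum-removeColumn {xs} desc pos =
    trans (sym (sum-addColumn (positives (map pred xs)) (length-μ≤length xs)))
      (cong sum (addColumn-removeColumn desc pos))

removeRow : List ℕ → ℕ × List ℕ
removeRow xs = largest xs , drop 1 xs

addRow : ℕ × List ℕ → List ℕ
addRow (zero  , μ) = μ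
addRow (suc h , μ) = suc h ∷ μ

removeRow-≃ : Partition n e ≃ Bordered largest n e
removeRow-≃ {n} {e} = record
  { to      = removeRow
  ; from    = addRow
  ; to-∈    = removeRow-bordered
  ; from-∈  = addRow-partition
  ; from∘to = addRow-removeRow
  ; to∘from = removeRow-addRow
  }
  where
  removeRow-bordered : ∀ {xs} → Partition n e xs → Bordered largest n e (removeRow xs)
  removeRow-bordered {[]} (_ , _ , size) = [] , [] , z≤n , size
  removeRow-bordered {x ∷ xs} (desc , (_ ∷ pos) , size) =
    Linked.tail desc , pos , at-≤ 0 (desc-head desc) , trans (cong (_+ e) (+-comm (sum xs) x)) size

  addRow-partition : ∀ {hμ} → Bordered largest n e hμ → Partition n e (addRow hμ)
  addRow-partition {zero , μ} (desc , pos , _ , size) =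
    desc , pos , trans (cong (_+ e) (sym (+-identityʳ (sum μ)))) size
  addRow-partition {suc h , μ} (desc , pos , μ₁≤h , size) =
    desc-∷ (All.map (λ x≤ → ≤-trans x≤ μ₁≤h) (all-≤-largest desc)) desc ,
    z<s ∷ pos ,
    trans (cong (_+ e) (+-comm (suc h) (sum μ))) size

  addRow-removeRow : ∀ {xs} → Partition n e xs → addRow (removeRow xs) ≡ xs
  addRow-removeRow {[]}         _ = refl
  addRow-removeRow {suc x ∷ xs} _ = refl
  addRow-removeRow {zero ∷ xs}  (_ , (() ∷ _) , _)

  removeRow-addRow : ∀ {hμ} → Bordered largest n e hμ → removeRow (addRow hμ) ≡ hμ
  removeRow-addRow {suc h , μ}    _ = refl
  removeRow-addRow {zero , []}    _ = refl
  removeRow-addRow {zero , x ∷ μ} (_ , (0<x ∷ _) , x≤0 , _) = contradiction x≤0 (<⇒≱ 0<x)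

Dominates : (f : List ℕ → ℕ) → ℤ → Pred (ℕ × List ℕ) 0ℓ
Dominates f s (b , μ) = + f μ ≤ℤ + b +ℤ s

translate : ℤ → ℕ × List ℕ → ℕ × List ℕ
translate s = map₁ (λ b → ∣ + b +ℤ s ∣)

+∣b+s∣≡b+s : ∀ b s {k} → + k ≤ℤ + b +ℤ s → + ∣ + b +ℤ s ∣ ≡ + b +ℤ s
+∣b+s∣≡b+s b s k≤b+s = ℤ.0≤i⇒+∣i∣≡i (ℤ.≤-trans (+≤+ z≤n) k≤b+s)

+∣b+s∣+t≡b : ∀ b s t {k} → s +ℤ t ≡ 0ℤ → + k ≤ℤ + b +ℤ s → + ∣ + b +ℤ s ∣ +ℤ t ≡ + b
+∣b+s∣+t≡b b s t s+t≡0 k≤b+s = begin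
  + ∣ + b +ℤ s ∣ +ℤ t ≡⟨ cong (_+ℤ t) (+∣b+s∣≡b+s b s k≤b+s) ⟩
  + b +ℤ s +ℤ t       ≡⟨ ℤ.+-assoc (+ b) s t ⟩
  + b +ℤ (s +ℤ t)     ≡⟨ cong (+ b +ℤ_) s+t≡0 ⟩
  + b +ℤ 0ℤ           ≡⟨ ℤ.+-identityʳ (+ b) ⟩
  + b                 ∎
  where open ≡-Reasoning

translate-bordered : ∀ f g s t → s +ℤ t ≡ 0ℤ → + e ≡ + e′ +ℤ s → ∀ {b μ} →
  Bordered f n e (b , μ) → Dominates g s (b , μ) →
  Bordered g n e′ (translate s (b , μ)) × Dominates f t (translate s (b , μ))
translate-bordered {e} {e′} f g s t s+t≡0 e≡e′+s {b} {μ} (desc , pos , f≤b , size) g≤b+s =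
  (desc , pos , ℤ.drop‿+≤+ (subst (+ g μ ≤ℤ_) (sym b′≡b+s) g≤b+s) ,
    trans (ℤ.+-injective size≡) size) ,
  subst (+ f μ ≤ℤ_) (sym (+∣b+s∣+t≡b b s t s+t≡0 g≤b+s)) (+≤+ f≤b)
  where
  b′ = ∣ + b +ℤ s ∣
  b′≡b+s : + b′ ≡ + b +ℤ s
  b′≡b+s = +∣b+s∣≡b+s b s g≤b+s
  size≡ : + (sum μ + b′ + e′) ≡ + (sum μ + b + e)
  size≡ = begin
    + sum μ +ℤ + b′ +ℤ + e′         ≡⟨ cong (λ h → + sum μ +ℤ h +ℤ + e′) b′≡b+s ⟩
    + sum μ +ℤ (+ b +ℤ s) +ℤ + e′   ≡⟨ regroup (+ sum μ) (+ b) s (+ e′) ⟩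
    + sum μ +ℤ + b +ℤ (+ e′ +ℤ s)   ≡⟨ cong (+ sum μ +ℤ + b +ℤ_) e≡e′+s ⟨
    + sum μ +ℤ + b +ℤ + e           ∎
    where
    open ≡-Reasoning
    regroup : ∀ m b s e → m +ℤ (b +ℤ s) +ℤ e ≡ m +ℤ b +ℤ (e +ℤ s)
    regroup = ℤSolver.solve-∀

translate-≃ : ∀ f g s → + e ≡ + e′ +ℤ s →
  Bordered f n e ∩ Dominates g s ≃ Bordered g n e′ ∩ Dominates f (- s)
translate-≃ {e} {e′} f g s e≡e′+s = record
  { to      = translate s
  ; from    = translate (- s)
  ; to-∈    = λ (bordered , g≤b+s) → translate-bordered f g s (- s) s-s≡0 e≡e′+s bordered g≤b+s
  ; from-∈  = λ (bordered , f≤b-s) → translate-bordered g f (- s) s -s+s≡0 e′≡e-s bordered f≤b-s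
  ; from∘to = λ { {b , μ} (_ , g≤b+s) →
      cong (λ i → ∣ i ∣ , μ) (+∣b+s∣+t≡b b s (- s) s-s≡0 g≤b+s) }
  ; to∘from = λ { {b , μ} (_ , f≤b-s) →
      cong (λ i → ∣ i ∣ , μ) (+∣b+s∣+t≡b b (- s) s -s+s≡0 f≤b-s) }
  }
  where
  s-s≡0 : s - s ≡ 0ℤ
  s-s≡0 = ℤ.+-inverseʳ s
  -s+s≡0 : - s +ℤ s ≡ 0ℤ
  -s+s≡0 = ℤ.+-inverseˡ s
  e′≡e-s : + e′ ≡ + e - s
  e′≡e-s = trans (sym (cancel (+ e′) s)) (cong (_- s) (sym e≡e′+s))
    where
    cancel : ∀ e s → e +ℤ s - s ≡ e
    cancel = ℤSolver.solve-∀

rank : List ℕ → ℤ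
rank xs = + largest xs - + length xs

difference≡⇒≤⇔≤ : ∀ {i j k l} → j - i ≡ l - k → i ≤ℤ j ⇔ k ≤ℤ l
difference≡⇒≤⇔≤ eq = mk⇔ (transport eq) (transport (sym eq))
  where
  transport : ∀ {i j k l} → j - i ≡ l - k → i ≤ℤ j → k ≤ℤ l
  transport eq i≤j = ℤ.0≤i-j⇒j≤i (subst (0ℤ ≤ℤ_) eq (ℤ.i≤j⇒0≤j-i i≤j))

s≢-1⇒0≤1+s⇔0≤s : ∀ {s} → s ≢ -1ℤ → 0ℤ ≤ℤ 1ℤ +ℤ s ⇔ 0ℤ ≤ℤ s
s≢-1⇒0≤1+s⇔0≤s {s} s≢-1 = mk⇔
  (λ 0≤1+s → ℤ.i<j⇒suc[i]≤j (ℤ.≤∧≢⇒< (Equivalence.to 0≤1+s⇔-1≤s 0≤1+s) (s≢-1 ∘ sym)))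
  ℤ.i≤j⇒i≤1+j
  where
  regroup : ∀ s → 1ℤ +ℤ s - 0ℤ ≡ s - -1ℤ
  regroup = ℤSolver.solve-∀
  0≤1+s⇔-1≤s : 0ℤ ≤ℤ 1ℤ +ℤ s ⇔ -1ℤ ≤ℤ s
  0≤1+s⇔-1≤s = difference≡⇒≤⇔≤ (regroup s)

removeColumn-rank-≃ : ∀ s → (e ≡ n → s ≢ -1ℤ) →
  Partition n e ∩ (λ xs → rank xs ≤ℤ s +ℤ 1ℤ) ≃ Bordered length n e ∩ Dominates largest s
removeColumn-rank-≃ {e} {n} s s≢-1 = ≃-∩ removeColumn-≃ rank≤⇔dominates
  where
  rank≤⇔dominates : ∀ {xs} → Partition n e xs →
    rank xs ≤ℤ s +ℤ 1ℤ ⇔ Dominates largest s (removeColumn xs)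
  rank≤⇔dominates {[]} (_ , _ , e≡n) rewrite ℤ.+-identityˡ s | ℤ.+-comm s 1ℤ =
    s≢-1⇒0≤1+s⇔0≤s (s≢-1 e≡n)
  rank≤⇔dominates {suc x ∷ xs} (desc , _) rewrite largest-positives (map-pred-desc desc) =
    difference≡⇒≤⇔≤ (regroup (+ x) (+ length xs) s)
    where
    regroup : ∀ x l s → s +ℤ 1ℤ - (1ℤ +ℤ x - (1ℤ +ℤ l)) ≡ 1ℤ +ℤ l +ℤ s - x
    regroup = ℤSolver.solve-∀
  rank≤⇔dominates {zero ∷ xs} (_ , (() ∷ _) , _)

removeRow-rank-≃ : ∀ s → (e ≡ n → s ≢ 1ℤ) →
  Partition n e ∩ (λ xs → s - 1ℤ ≤ℤ rank xs) ≃ Bordered largest n e ∩ Dominates length (- s)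
removeRow-rank-≃ {e} {n} s s≢1 = ≃-∩ removeRow-≃ rank≥⇔dominates
  where
  rank≥⇔dominates : ∀ {xs} → Partition n e xs →
    s - 1ℤ ≤ℤ rank xs ⇔ Dominates length (- s) (removeRow xs)
  rank≥⇔dominates {[]} (_ , _ , e≡n) rewrite ℤ.+-identityˡ (- s) =
    s≢-1⇒0≤1+s⇔0≤s -s≢-1 ⇔-∘ difference≡⇒≤⇔≤ (regroup s)
    where
    regroup : ∀ s → 0ℤ - (s - 1ℤ) ≡ 1ℤ +ℤ - s - 0ℤ
    regroup = ℤSolver.solve-∀
    -s≢-1 : - s ≢ -1ℤ
    -s≢-1 -s≡-1 = s≢1 e≡n (ℤ.neg-injective -s≡-1)
  rank≥⇔dominates {x ∷ xs} _ = difference≡⇒≤⇔≤ (regroup (+ x) (+ length xs) s)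
    where
    regroup : ∀ x l s → x - (1ℤ +ℤ l) - (s - 1ℤ) ≡ x - s - l
    regroup = ℤSolver.solve-∀

-- The empty partition has rank s + 1 for s = −1, but no row of length −1 can be added to it;
-- s = 1 is the dual case for the inverse map.
dyson-≃ : ∀ s → + e ≡ + e′ +ℤ s → (e ≡ n → s ≢ -1ℤ) → (e′ ≡ n → s ≢ 1ℤ) →
  Partition n e ∩ (λ xs → rank xs ≤ℤ s +ℤ 1ℤ) ≃ Partition n e′ ∩ (λ xs → s - 1ℤ ≤ℤ rank xs)
dyson-≃ s e≡e′+s s≢-1 s≢1 = ≃-trans (removeColumn-rank-≃ s s≢-1)
  (≃-trans (translate-≃ length largest s e≡e′+s) (≃-sym (removeRow-rank-≃ s s≢1)))

-- The pentagonal recurrence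

module R₁ = Residue 1 3 z<s (s<s z<s)
module R₂ = Residue 2 3 z<s (s<s (s<s z<s))

-- j(3j+1)/2, which is 2 + 5 + ⋯ + (3j − 1) for j ≥ 0 and 1 + 4 + ⋯ + (3|j| − 2) for j < 0.
pentagonal : ℤ → ℕ
pentagonal (+ k)    = R₂.staircase k
pentagonal -[1+ k ] = R₁.staircase (suc k)

gap : ℤ → ℤ
gap j = + 3 *ℤ j +ℤ + 2

pentagonal-suc : ∀ j → + pentagonal (ℤ.suc j) ≡ + pentagonal j +ℤ gap j
pentagonal-suc (+ k) = cong (+ R₂.staircase k +ℤ_)
  (trans (cong (+ 2 +ℤ_) (ℤ.pos-* 3 k)) (ℤ.+-comm (+ 2) (+ 3 *ℤ + k)))
pentagonal-suc -[1+ zero ] = refl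
pentagonal-suc -[1+ suc k ] = begin
  + w                                                   ≡⟨ regroup (+ w) (+ k) ⟩
  + w +ℤ (1ℤ +ℤ + 3 *ℤ + suc k) +ℤ gap -[1+ suc k ]     ≡⟨ cong (λ x → + w +ℤ (1ℤ +ℤ x) +ℤ gap -[1+ suc k ])
                                                             (ℤ.pos-* 3 (suc k)) ⟨
  + w +ℤ (1ℤ +ℤ + (3 * suc k)) +ℤ gap -[1+ suc k ]      ∎
  where
  open ≡-Reasoning
  w = R₁.staircase (suc k)
  regroup : ∀ s k → s ≡ s +ℤ (1ℤ +ℤ + 3 *ℤ (1ℤ +ℤ k)) +ℤ (+ 3 *ℤ (- (+ 2 +ℤ k)) +ℤ + 2)
  regroup = ℤSolver.solve-∀

3*suc≡gap+1 : ∀ j → + 3 *ℤ ℤ.suc j ≡ gap j +ℤ 1ℤ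
3*suc≡gap+1 = regroup
  where
  regroup : ∀ j → + 3 *ℤ (1ℤ +ℤ j) ≡ + 3 *ℤ j +ℤ + 2 +ℤ 1ℤ
  regroup = ℤSolver.solve-∀

gap-1≡suc-3* : ∀ j → gap j - 1ℤ ≡ ℤ.suc (+ 3 *ℤ j)
gap-1≡suc-3* = regroup
  where
  regroup : ∀ j → + 3 *ℤ j +ℤ + 2 - 1ℤ ≡ 1ℤ +ℤ + 3 *ℤ j
  regroup = ℤSolver.solve-∀

gap≡-1⇒suc≡0 : ∀ j → gap j ≡ -1ℤ → ℤ.suc j ≡ 0ℤ
gap≡-1⇒suc≡0 j gap≡-1
  with ℤ.i*j≡0⇒i≡0∨j≡0 (+ 3) (trans (3*suc≡gap+1 j) (cong (_+ℤ 1ℤ) gap≡-1))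
... | inj₂ suc≡0 = suc≡0

gap≢1 : ∀ j → gap j ≢ 1ℤ
gap≢1 j gap≡1 = contradiction (m*n≡1⇒m≡1 3 ∣ j ∣ 3∣j∣≡1) λ ()
  where
  cancel : ∀ j → + 3 *ℤ j +ℤ + 2 - + 2 ≡ + 3 *ℤ j
  cancel = ℤSolver.solve-∀
  3∣j∣≡1 : 3 * ∣ j ∣ ≡ 1
  3∣j∣≡1 = begin
    3 * ∣ j ∣       ≡⟨ ℤ.abs-* (+ 3) j ⟨
    ∣ + 3 *ℤ j ∣    ≡⟨ cong ∣_∣ (cancel j) ⟨
    ∣ gap j - + 2 ∣ ≡⟨ cong (λ i → ∣ i - + 2 ∣) gap≡1 ⟩
    1               ∎
    where open ≡-Reasoning

#rank≤ : ℕ → ℤ → ℕ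
#rank≤ n j = #partitions n (pentagonal j) (λ xs → rank xs ≤ℤ? + 3 *ℤ j)

module _ {n : ℕ} (0<n : 0 < n) where

  #rank≤-suc : ∀ j → #rank≤ n (ℤ.suc j) ≡ #partitions n (pentagonal j) (λ xs → gap j - 1ℤ ≤ℤ? rank xs)
  #rank≤-suc j = begin
    #rank≤ n (ℤ.suc j)
      ≡⟨ cong (λ r → #partitions n (pentagonal (ℤ.suc j)) (λ xs → rank xs ≤ℤ? r)) (3*suc≡gap+1 j) ⟩
    #partitions n (pentagonal (ℤ.suc j)) (λ xs → rank xs ≤ℤ? gap j +ℤ 1ℤ)
      ≡⟨ #partitions-≃ n (λ xs → rank xs ≤ℤ? gap j +ℤ 1ℤ) (λ xs → gap j - 1ℤ ≤ℤ? rank xs)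
           (dyson-≃ (gap j) (pentagonal-suc j) gap≢-1 (λ _ → gap≢1 j)) ⟩
    #partitions n (pentagonal j) (λ xs → gap j - 1ℤ ≤ℤ? rank xs) ∎
    where
    open ≡-Reasoning
    gap≢-1 : pentagonal (ℤ.suc j) ≡ n → gap j ≢ -1ℤ
    gap≢-1 pent≡n gap≡-1 =
      <⇒≢ 0<n (trans (sym (cong pentagonal (gap≡-1⇒suc≡0 j gap≡-1))) pent≡n)

  #rank≤-recurrence : ∀ j → #rank≤ n j + #rank≤ n (ℤ.suc j) ≡ length (partitions n (pentagonal j))
  #rank≤-recurrence j = trans (cong (λ c → #rank≤ n j + c) (#rank≤-suc j))
    (length-filter-+-∁ (λ xs → rank xs ≤ℤ? + 3 *ℤ j) (λ xs → gap j - 1ℤ ≤ℤ? rank xs)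
      (rank≥⇒rank≰ , rank≰⇒rank≥) (partitions n (pentagonal j)))
    where
    rank≥⇒rank≰ : ∀ {r} → gap j - 1ℤ ≤ℤ r → ¬ r ≤ℤ + 3 *ℤ j
    rank≥⇒rank≰ {r} r≥ = ℤ.<⇒≱ (ℤ.suc[i]≤j⇒i<j (subst (_≤ℤ r) (gap-1≡suc-3* j) r≥))
    rank≰⇒rank≥ : ∀ {r} → ¬ r ≤ℤ + 3 *ℤ j → gap j - 1ℤ ≤ℤ r
    rank≰⇒rank≥ {r} r≰ = subst (_≤ℤ r) (sym (gap-1≡suc-3* j)) (ℤ.i<j⇒suc[i]≤j (ℤ.≰⇒> r≰))

  #rank≤-recurrence-neg : ∀ k →
    #rank≤ n (- + k) + #rank≤ n -[1+ k ] ≡ length (partitions n (R₁.staircase (suc k)))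
  #rank≤-recurrence-neg k = begin
    #rank≤ n (- + k) + #rank≤ n -[1+ k ]
      ≡⟨ +-comm (#rank≤ n (- + k)) (#rank≤ n -[1+ k ]) ⟩
    #rank≤ n -[1+ k ] + #rank≤ n (- + k)
      ≡⟨ cong (λ j → #rank≤ n -[1+ k ] + #rank≤ n j) (ℤ.1-[1+n]≡-n k) ⟨
    #rank≤ n -[1+ k ] + #rank≤ n (ℤ.suc -[1+ k ])
      ≡⟨ #rank≤-recurrence -[1+ k ] ⟩
    length (partitions n (R₁.staircase (suc k))) ∎
    where open ≡-Reasoning

#rank≤-vanishes : ∀ j → n < ∣ j ∣ → #rank≤ n j ≡ 0
#rank≤-vanishes j n<∣j∣ =
  #partitions-vanishes (λ xs → rank xs ≤ℤ? + 3 *ℤ j) (<-≤-trans n<∣j∣ (∣j∣≤pentagonal j))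
  where
  ∣j∣≤pentagonal : ∀ j → ∣ j ∣ ≤ pentagonal j
  ∣j∣≤pentagonal (+ k)    = R₂.k≤staircase k
  ∣j∣≤pentagonal -[1+ k ] = R₁.k≤staircase (suc k)

eventually-zero-unique : ∀ (X Y : ℕ → ℕ) b → (∀ k → X k + X (suc k) ≡ Y k + Y (suc k)) →
  (∀ k → b < k → X k ≡ 0) → (∀ k → b < k → Y k ≡ 0) → ∀ k → X k ≡ Y k
eventually-zero-unique X Y b step X≡0 Y≡0 k = descend (suc b) k (m≤m+n (suc b) k)
  where
  descend : ∀ d k → b < d + k → X k ≡ Y k
  descend zero    k b<k   = trans (X≡0 k b<k) (sym (Y≡0 k b<k))
  descend (suc d) k b<d+k = +-cancelʳ-≡ (X (suc k)) (X k) (Y k) (begin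
    X k + X (suc k) ≡⟨ step k ⟩
    Y k + Y (suc k) ≡⟨ cong (λ y → Y k + y) (descend d (suc k) b<d+suc-k) ⟨
    Y k + X (suc k) ∎)
    where
    open ≡-Reasoning
    b<d+suc-k : b < d + suc k
    b<d+suc-k = subst (b <_) (sym (+-suc d k)) b<d+k

module _ {n : ℕ} (0<n : 0 < n) where

  #skipping₂≡#rank≤ : ∀ k → R₂.#skipping n k ≡ #rank≤ n (+ k)
  #skipping₂≡#rank≤ = eventually-zero-unique (R₂.#skipping n) (λ k → #rank≤ n (+ k)) n
    (λ k → trans (R₂.#skipping-recurrence n k) (sym (#rank≤-recurrence 0<n (+ k))))
    (λ _ → R₂.#skipping-vanishes)
    (λ k → #rank≤-vanishes (+ k))

  #skipping₁≡#rank≤ : ∀ k → R₁.#skipping n (suc k) ≡ #rank≤ n (- + k)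
  #skipping₁≡#rank≤ = eventually-zero-unique (R₁.#skipping n ∘ suc) (λ k → #rank≤ n (- + k)) n
    (λ k → trans (R₁.#skipping-recurrence n (suc k)) (sym (#rank≤-recurrence-neg 0<n k)))
    (λ _ n<k → R₁.#skipping-vanishes (m<n⇒m<1+n n<k))
    (λ { (suc k) → #rank≤-vanishes -[1+ k ] })

  #skipping₂-0≡#skipping₁-1 : R₂.#skipping n 0 ≡ R₁.#skipping n 1
  #skipping₂-0≡#skipping₁-1 = trans (#skipping₂≡#rank≤ 0) (sym (#skipping₁≡#rank≤ 0))

-- The truncated sums

alternating-telescope : ∀ {f : ℕ → ℕ} (X : ℕ → ℕ) k → (∀ {τ} → τ ≤ k → f τ ≡ X τ + X (suc τ)) →
  sumTo k (λ τ → (-1ℤ ^ τ) *ℤ + f τ) ≡ + X 0 - (-1ℤ ^ suc k) *ℤ + X (suc k)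
alternating-telescope X zero f≡ rewrite f≡ z≤n = regroup (+ X 0) (+ X 1)
  where
  regroup : ∀ x y → 1ℤ *ℤ (x +ℤ y) ≡ x - (-1ℤ *ℤ 1ℤ) *ℤ y
  regroup = ℤSolver.solve-∀
alternating-telescope X (suc k) f≡ rewrite f≡ (≤-refl {suc k}) = trans
  (cong (_+ℤ (-1ℤ ^ suc k) *ℤ + (X (suc k) + X (2+ k)))
    (alternating-telescope X k (λ τ≤k → f≡ (m≤n⇒m≤1+n τ≤k))))
  (regroup (+ X 0) (-1ℤ ^ suc k) (+ X (suc k)) (+ X (2+ k)))
  where
  regroup : ∀ x s y z → x - s *ℤ y +ℤ s *ℤ (y +ℤ z) ≡ x - (-1ℤ *ℤ s) *ℤ z
  regroup = ℤSolver.solve-∀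

-1^k*-1^k≡1 : ∀ k → (-1ℤ ^ k) *ℤ (-1ℤ ^ k) ≡ 1ℤ
-1^k*-1^k≡1 zero    = refl
-1^k*-1^k≡1 (suc k) = trans (square (-1ℤ ^ k)) (-1^k*-1^k≡1 k)
  where
  square : ∀ s → (-1ℤ *ℤ s) *ℤ (-1ℤ *ℤ s) ≡ s *ℤ s
  square = ℤSolver.solve-∀

telescoped-difference : ∀ k {x x′} y z → x ≡ x′ →
  (-1ℤ ^ k) *ℤ ((x - (-1ℤ ^ suc k) *ℤ y) - (x′ - (-1ℤ ^ k) *ℤ z)) ≡ y +ℤ z
telescoped-difference k {x} y z refl = begin
  s *ℤ ((x - (-1ℤ *ℤ s) *ℤ y) - (x - s *ℤ z)) ≡⟨ regroup s x y z ⟩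
  (s *ℤ s) *ℤ (y +ℤ z)                        ≡⟨ cong (_*ℤ (y +ℤ z)) (-1^k*-1^k≡1 k) ⟩
  1ℤ *ℤ (y +ℤ z)                              ≡⟨ ℤ.*-identityˡ (y +ℤ z) ⟩
  y +ℤ z                                      ∎
  where
  open ≡-Reasoning
  s = -1ℤ ^ k
  regroup : ∀ s x y z → s *ℤ ((x - (-1ℤ *ℤ s) *ℤ y) - (x - s *ℤ z)) ≡ (s *ℤ s) *ℤ (y +ℤ z)
  regroup = ℤSolver.solve-∀

m*2≡n⇒n/2≡m : ∀ {m n} → m * 2 ≡ n → n / 2 ≡ m
m*2≡n⇒n/2≡m {m} refl = m*n/n≡m m 2

k[3k+1]/2≡staircase₂ : ∀ k → k * (3 * k + 1) / 2 ≡ R₂.staircase k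
k[3k+1]/2≡staircase₂ k = m*2≡n⇒n/2≡m
  (+-cancelʳ-≡ (3 * k) (R₂.staircase k * 2) (k * (3 * k + 1)) (trans (R₂.staircase*2 k) (expand k)))
  where
  expand : ∀ k → k * (4 + 3 * k) ≡ k * (3 * k + 1) + 3 * k
  expand = solve-∀

1+k[3k+5]/2≡staircase₁ : ∀ k → suc (k * (3 * k + 5) / 2) ≡ R₁.staircase (suc k)
1+k[3k+5]/2≡staircase₁ k = trans (cong suc (m*2≡n⇒n/2≡m twice)) (sym (+-suc (R₁.staircase k) (3 * k)))
  where
  twice : (R₁.staircase k + 3 * k) * 2 ≡ k * (3 * k + 5)
  twice = begin
    (R₁.staircase k + 3 * k) * 2       ≡⟨ expand (R₁.staircase k) k ⟩
    R₁.staircase k * 2 + 3 * k + 3 * k ≡⟨ cong (_+ 3 * k) (R₁.staircase*2 k) ⟩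
    k * (2 + 3 * k) + 3 * k            ≡⟨ collect k ⟩
    k * (3 * k + 5)                    ∎
    where
    open ≡-Reasoning
    expand : ∀ s k → (s + 3 * k) * 2 ≡ s * 2 + 3 * k + 3 * k
    expand = solve-∀
    collect : ∀ k → k * (2 + 3 * k) + 3 * k ≡ k * (3 * k + 5)
    collect = solve-∀

k[3k+c]/2-mono-≤ : ∀ {c d k l} → c ≤ d → k ≤ l → k * (3 * k + c) / 2 ≤ l * (3 * l + d) / 2
k[3k+c]/2-mono-≤ c≤d k≤l = /-monoˡ-≤ 2 (*-mono-≤ k≤l (+-mono-≤ (*-monoʳ-≤ 3 k≤l) c≤d))

module _ (ν n : ℕ) (bound : ν * (3 * ν + 5) / 2 < n) where

  p-recurrence₂ : ∀ {τ} → τ ≤ ν →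
    p (n ∸ τ * (3 * τ + 1) / 2) ≡ R₂.#skipping n τ + R₂.#skipping n (suc τ)
  p-recurrence₂ {τ} τ≤ν =
    trans (cong (λ e → p (n ∸ e)) (k[3k+1]/2≡staircase₂ τ)) (R₂.p-recurrence n τ staircase≤n)
    where
    staircase≤n : R₂.staircase τ ≤ n
    staircase≤n = subst (_≤ n) (k[3k+1]/2≡staircase₂ τ)
      (≤-trans (k[3k+c]/2-mono-≤ (s≤s z≤n) τ≤ν) (<⇒≤ bound))

  p-recurrence₁ : ∀ {τ} → τ ≤ ν →
    p (n ∸ τ * (3 * τ + 5) / 2 ∸ 1) ≡ R₁.#skipping n (suc τ) + R₁.#skipping n (2+ τ)
  p-recurrence₁ {τ} τ≤ν = begin
    p (n ∸ τ * (3 * τ + 5) / 2 ∸ 1)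
      ≡⟨ cong p (pred[m∸n]≡m∸[1+n] n (τ * (3 * τ + 5) / 2)) ⟩
    p (n ∸ suc (τ * (3 * τ + 5) / 2))
      ≡⟨ cong (λ e → p (n ∸ e)) (1+k[3k+5]/2≡staircase₁ τ) ⟩
    p (n ∸ R₁.staircase (suc τ))
      ≡⟨ R₁.p-recurrence n (suc τ) staircase≤n ⟩
    R₁.#skipping n (suc τ) + R₁.#skipping n (2+ τ) ∎
    where
    open ≡-Reasoning
    staircase≤n : R₁.staircase (suc τ) ≤ n
    staircase≤n = subst (_≤ n) (1+k[3k+5]/2≡staircase₁ τ)
      (≤-<-trans (k[3k+c]/2-mono-≤ ≤-refl τ≤ν) bound)

theorem1p3 : (ν n : ℕ) → 1 ≤ ν → ν * (3 * ν + 5) / 2 < n →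
    (-1ℤ ^ ν) *ℤ
      ( sumTo ν (λ τ → (-1ℤ ^ τ) *ℤ (+ p (n ∸ τ * (3 * τ + 1) / 2)))
      - sumTo (ν ∸ 1) (λ τ → (-1ℤ ^ τ) *ℤ (+ p (n ∸ τ * (3 * τ + 5) / 2 ∸ 1))) )
    ≡ + (pν 2 3 ν n + pν 1 3 ν n)
theorem1p3 ν@(suc k) n _ bound = begin
  (-1ℤ ^ ν) *ℤ
    ( sumTo ν (λ τ → (-1ℤ ^ τ) *ℤ (+ p (n ∸ τ * (3 * τ + 1) / 2)))
    - sumTo k (λ τ → (-1ℤ ^ τ) *ℤ (+ p (n ∸ τ * (3 * τ + 5) / 2 ∸ 1))) )
    ≡⟨ cong₂ (λ S T → (-1ℤ ^ ν) *ℤ (S - T))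
         (alternating-telescope S₂ ν (p-recurrence₂ ν n bound))
         (alternating-telescope (S₁ ∘ suc) k (λ τ≤k → p-recurrence₁ ν n bound (m≤n⇒m≤1+n τ≤k))) ⟩
  (-1ℤ ^ ν) *ℤ ((+ S₂ 0 - (-1ℤ ^ suc ν) *ℤ + S₂ (suc ν)) - (+ S₁ 1 - (-1ℤ ^ ν) *ℤ + S₁ (suc ν)))
    ≡⟨ telescoped-difference ν (+ S₂ (suc ν)) (+ S₁ (suc ν))
         (cong (λ x → + x) (#skipping₂-0≡#skipping₁-1 (≤-<-trans z≤n bound))) ⟩
  + (S₂ (suc ν) + S₁ (suc ν))
    ≡⟨ cong₂ (λ x y → + (x + y)) (R₂.pν≡#skipping ν n) (R₁.pν≡#skipping ν n) ⟨
  + (pν 2 3 ν n + pν 1 3 ν n) ∎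
  where
  open ≡-Reasoning
  S₁ S₂ : ℕ → ℕ
  S₁ = R₁.#skipping n
  S₂ = R₂.#skipping n
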